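{- Let $d_n^B(x;1/2)$ be defined by $\sum_{n\ge0}d_n^B(x;1/2)\frac{z^n}{n!}=\left(\frac{(1-x)e^{z/2}}{e^{xz}-xe^{z}}\right)^{2}$. For $n\geq1$, $$d_n^B(x;1/2)=\frac{1}{x}d_{n+1}(x)+d_n(x),$$ and $$d_n^B(x;1/2)=\sum_{\pi\in\mathfrak{S}_{n+1}^s}x^{\mathrm{asc}(\pi)}.$$
   Context: $d_n(x)=\sum_{\pi}x^{\mathrm{exc}(\pi)}$ is the classical derangement polynomial, the sum over permutations $\pi\in\mathfrak{S}_n$ with no fixed points, where $\mathrm{exc}(\pi)=\#\{i:\pi(i)>i\}$ (with $d_0(x)=1$). For $\pi\in\mathfrak{S}_n$, an ascent is $i\in[n-1]$ with $\pi(i)<\pi(i+1)$, $\mathrm{asc}(\pi)$ is the number of ascents, and a succession is $i\in[n-1]$ with $\pi(i+1)=\pi(i)+1$; $\mathfrak{S}_n^s$ is the set of permutations in $\mathfrak{S}_n$ with no successions. -}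

module Defs where

open import Algebra.Bundles.Raw using (RawRing)
open import Data.Fin.Base as Fin using (Fin; toℕ; inject₁)
import Data.Fin.Properties as Fin
import Data.Integer.Base as ℤ
open import Data.List.Base as List using (List; cartesianProductWith; filter; foldr)
open import Data.Nat.Base as ℕ using (ℕ; zero; suc; _!)
import Data.Nat.Properties as ℕ
open import Data.Product.Base using (_,_; proj₁; proj₂)
open import Data.Rational.Base as ℚ using (ℚ)
open import Data.Vec.Base as Vec using (Vec; []; _∷_; lookup)
open import Function.Base using (_∘_)
open import Function.Definitions using (Bijective)
open import Relation.Binary.PropositionalEquality using (_≡_; _≢_; refl)
open import Relation.Nullary.Decidable using (Dec; map′; _×-dec_; _→-dec_; ¬?)
open import Relation.Nullary.Negation.Core using (¬_)
import Algebra.Definitions.RawSemiring as RawSemiringDefs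

-- Formal power series over R, as coefficient sequences: f n is the
-- coefficient of the n-th power of the variable.
module Series {c ℓ} (R : RawRing c ℓ) where

  private module R = RawRing R

  Series : Set c
  Series = ℕ → R.Carrier

  const : R.Carrier → Series
  const a zero    = a
  const a (suc _) = R.0#

  var : Series
  var (suc zero) = R.1#
  var _          = R.0#

  -- Cauchy product: (f · g) n = f 0 * g n + f 1 * g (n - 1) + … + f n * g 0
  infixl 7 _·_
  _·_ : Series → Series → Series
  (f · g) zero    = f 0 R.* g 0
  (f · g) (suc n) = f 0 R.* g (suc n) R.+ ((f ∘ suc) · g) n

  rawRing : RawRing c ℓ
  rawRing = record
    { Carrier = Series
    ; _≈_     = λ f g → ∀ n → f n R.≈ g n
    ; _+_     = λ f g n → f n R.+ g n
    ; _*_     = _·_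
    ; -_      = λ f n → R.- f n
    ; 0#      = const R.0#
    ; 1#      = const R.1#
    }

  dot : ∀ {m} → Series → Vec R.Carrier m → R.Carrier
  dot h []       = R.0#
  dot h (a ∷ as) = h 0 R.* a R.+ dot (h ∘ suc) as

  -- The multiplicative inverse g of a series f, where u must be the inverse
  -- in R of the constant term f 0:
  --   g 0 = u,   g (n + 1) = - u * (f 1 * g n + f 2 * g (n - 1) + … + f (n + 1) * g 0).
  module _ (u : R.Carrier) (f : Series) where

    -- g n ∷ g (n - 1) ∷ … ∷ g 0 ∷ []
    inverseCoeffs : (n : ℕ) → Vec R.Carrier (suc n)
    inverseCoeffs zero    = u ∷ []
    inverseCoeffs (suc n) =
      (R.- (u R.* dot (f ∘ suc) (inverseCoeffs n))) ∷ inverseCoeffs n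

    inverse : Series
    inverse n = Vec.head (inverseCoeffs n)

module ℚ⟦x⟧ where
  open Series ℚ.+-*-rawRing public using (const; inverse) renaming (var to x)
  ring : RawRing _ _
  ring = Series.rawRing ℚ.+-*-rawRing
  open RawRing ring public using (Carrier; _≈_; _+_; _*_; -_; 0#; 1#)
  open RawSemiringDefs (RawRing.rawSemiring ring) public using (_^_)

module ℚ⟦x⟧⟦z⟧ where
  open Series ℚ⟦x⟧.ring public using (const; inverse)
  ring : RawRing _ _
  ring = Series.rawRing ℚ⟦x⟧.ring
  open RawRing ring public using (Carrier; _≈_; _+_; _*_; -_; 0#; 1#)
  open RawSemiringDefs (RawRing.rawSemiring ring) public using (_^_)

  1/_! : ℕ → ℚ
  1/ n ! = (ℤ.1ℤ ℚ./ (n !)) ⦃ n ℕ.!≢0 ⦄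

  -- exp a is e^(a z)
  exp : ℚ⟦x⟧.Carrier → Carrier
  exp a n = ℚ⟦x⟧.const 1/ n ! ℚ⟦x⟧.* (a ℚ⟦x⟧.^ n)

open ℚ⟦x⟧ using (x)

1-x : ℚ⟦x⟧.Carrier
1-x = 1# + - x
  where open ℚ⟦x⟧

1/[1-x] : ℚ⟦x⟧.Carrier
1/[1-x] = ℚ⟦x⟧.inverse ℚ.1ℚ 1-x

-- e^(x z) - x e^z; its constant term in z is 1 - x.
denominator : ℚ⟦x⟧⟦z⟧.Carrier
denominator = exp x + - (const x * exp ℚ⟦x⟧.1#)
  where open ℚ⟦x⟧⟦z⟧

-- ((1 - x) e^(z/2) / (e^(x z) - x e^z))²
dᴮ½-egf : ℚ⟦x⟧⟦z⟧.Carrier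
dᴮ½-egf = (const 1-x * exp (ℚ⟦x⟧.const ℚ.½) * inverse 1/[1-x] denominator) ^ 2
  where open ℚ⟦x⟧⟦z⟧

-- d_n^B(x; 1/2), that is, n! times the coefficient of zⁿ
dᴮ½ : ℕ → ℚ⟦x⟧.Carrier
dᴮ½ n = const (ℤ.+ (n !) ℚ./ 1) * dᴮ½-egf n
  where open ℚ⟦x⟧

-- Permutations in one-line notation; positions and values are 0, …, n - 1.
Word : ℕ → Set
Word n = Vec (Fin n) n

IsPermutation : ∀ {n} → Word n → Set
IsPermutation w = Bijective _≡_ _≡_ (lookup w)

isPermutation? : ∀ {n} (w : Word n) → Dec (IsPermutation w)
isPermutation? w = map′
  (λ (inj , surj) → (λ {i} {j} → inj i j) , λ j → proj₁ (surj j) , λ { refl → proj₂ (surj j) })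
  (λ (inj , surj) → (λ i j → inj {i} {j}) , λ j → proj₁ (surj j) , proj₂ (surj j) refl)
  (Fin.all? (λ i → Fin.all? (λ j → (lookup w i Fin.≟ lookup w j) →-dec (i Fin.≟ j)))
    ×-dec
   Fin.all? (λ j → Fin.any? (λ i → lookup w i Fin.≟ j)))

vectors : (n m : ℕ) → List (Vec (Fin n) m)
vectors n zero    = [] List.∷ List.[]
vectors n (suc m) = cartesianProductWith _∷_ (List.allFin n) (vectors n m)

𝔖 : (n : ℕ) → List (Word n)
𝔖 n = filter isPermutation? (vectors n n)

exc : ∀ {n} → Word n → ℕ
exc {n} w = Vec.count (λ i → i Fin.<? lookup w i) (Vec.allFin n)

Derangement : ∀ {n} → Word n → Set
Derangement w = ∀ i → lookup w i ≢ i

derangement? : ∀ {n} (w : Word n) → Dec (Derangement w)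
derangement? w = Fin.all? (λ i → ¬? (lookup w i Fin.≟ i))

-- For a word of length n + 1, the index i : Fin n stands for the pair of
-- adjacent positions inject₁ i and suc i.
asc : ∀ {n} → Word (suc n) → ℕ
asc {n} w = Vec.count (λ i → lookup w (inject₁ i) Fin.<? lookup w (Fin.suc i)) (Vec.allFin n)

Succession : ∀ {n} → Word (suc n) → Fin n → Set
Succession w i = toℕ (lookup w (Fin.suc i)) ≡ suc (toℕ (lookup w (inject₁ i)))

NoSuccessions : ∀ {n} → Word (suc n) → Set
NoSuccessions w = ∀ i → ¬ Succession w i

noSuccessions? : ∀ {n} (w : Word (suc n)) → Dec (NoSuccessions w)
noSuccessions? w = Fin.all? (λ i → ¬? (toℕ (lookup w (Fin.suc i)) ℕ.≟ suc (toℕ (lookup w (inject₁ i)))))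

𝔖ˢ : (n : ℕ) .⦃ _ : ℕ.NonZero n ⦄ → List (Word n)
𝔖ˢ (suc n) = filter noSuccessions? (𝔖 (suc n))

Σx^ : ∀ {a} {A : Set a} → (A → ℕ) → List A → ℚ⟦x⟧.Carrier
Σx^ stat = foldr (λ π s → x ^ stat π + s) 0#
  where open ℚ⟦x⟧

d : ℕ → ℚ⟦x⟧.Carrier
d n = Σx^ exc (filter derangement? (𝔖 n))

{-# OPTIONS --safe #-}

-- The operator D = x (1 - x) d/dx carries the whole proof. Inserting a smallest
-- element into a cycle (for excedances and fixed points) and into a word (for
-- non-succession ascents and successions) changes the joint distribution of the
-- two statistics in the same way, up to one additional copy of each word. Hence
-- both generating polynomials satisfy
--   g (n + 1) = D (g n) + (n x + k) g n + n x g (n - 1),   g 0 = 1,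
-- with k = 0 for derangements and k = 1 for succession-free permutations.
-- The generating function is handled through the derivation
-- Δ = (1 - x z) z ∂/∂z - z D of ℚ⟦x⟧⟦z⟧: each factor f of it satisfies Δ f = z r f with
-- an explicit rate r, the rates of the factors add up to 1 + x z for the whole
-- function, and this says that its coefficients satisfy the recurrence with k = 1.
-- Finally x times the solution for k = 1 and g (n + 1) + x g n, for the
-- solution g with k = 0, obey one common recurrence.
module Submission where

open import Defs
open import Algebra.Bundles using (CommutativeRing)
open import Algebra.Bundles.Raw using (RawRing)
import Algebra.Definitions.RawSemiring as RawSemiringDefs
import Algebra.Properties.Ring as RingProperties
import Algebra.Properties.Semiring.Mult as SemiringMult
import Algebra.Properties.Semiring.Mult.TCOptimised as SemiringMult′
import Algebra.Properties.Semiring.Sum as SemiringSum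
import Algebra.Solver.Ring as RingSolver
open import Algebra.Solver.Ring.AlmostCommutativeRing using (fromCommutativeRing; _-Raw-AlmostCommutative⟶_)
open import Data.Bool.Base using (true; false; if_then_else_)
open import Data.Fin.Base as Fin using (Fin; zero; suc; toℕ; inject₁; fromℕ; punchIn)
open import Data.Fin.Permutation as FinPerm using (Permutation′; _⟨$⟩ʳ_; _⟨$⟩ˡ_; inverseˡ; inverseʳ)
import Data.Fin.Properties as Fin
import Data.Integer.Base as ℤ
import Data.Integer.Properties as ℤ
open import Data.List.Base as List using (List; []; _∷_; _++_; foldr; map; filter; cartesianProductWith; allFin)
open import Data.List.Membership.Propositional using (_∈_)
open import Data.List.Membership.Propositional.Properties using (∈-filter⁺; ∈-filter⁻; ∈-allFin; ∈-cartesianProductWith⁺; ∈-cartesianProductWith⁻)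
open import Data.List.Membership.Propositional.Properties.WithK using (unique∧set⇒bag)
open import Data.List.Relation.Binary.BagAndSetEquality using (∼bag⇒↭)
open import Data.List.Relation.Binary.Permutation.Propositional as Perm using (_↭_)
import Data.List.Relation.Unary.All as All
import Data.List.Relation.Unary.AllPairs as AllPairs
open import Data.List.Relation.Unary.Any using (here; there)
open import Data.List.Relation.Unary.Unique.Propositional using (Unique)
import Data.List.Relation.Unary.Unique.Propositional.Properties as Unique
open import Data.Maybe.Base using (Maybe; just; nothing)
open import Data.Nat.Base as ℕ using (ℕ; zero; suc; pred; _!; _≤_)
import Data.Nat.Properties as ℕ
import Data.Product.Base as Product
open Product using (_,_; proj₁; proj₂; ∃)
open import Data.Rational.Base as ℚ using (ℚ; fromℚᵘ)
import Data.Rational.Properties as ℚ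
import Data.Rational.Unnormalised.Base as ℚᵘ
open ℚᵘ using (mkℚᵘ; *≡*)
import Data.Rational.Unnormalised.Properties as ℚᵘ
open import Data.Vec.Base as Vec using (Vec; []; _∷_; lookup; tabulate; insertAt)
open import Data.Vec.Properties using (∷-injective; lookup∘tabulate; tabulate∘lookup; lookup-map; tabulate-cong; insertAt-lookup; insertAt-punchIn)
open import Function.Base using (_∘_; id)
open import Function.Bundles using (mk⇔)
open import Level using (_⊔_)
import Relation.Binary.PropositionalEquality as ≡
open ≡ using (_≡_)
import Relation.Binary.Reasoning.Setoid as SetoidReasoning
open import Relation.Nullary.Decidable using (Dec; does; yes; no)
open import Relation.Nullary.Negation using (¬_; contradiction)
open import Relation.Unary using (Pred; Decidable)

-- The shape of `Δ` comes from the recurrence itself: for F = Σ g(n) zⁿ/n!, the case k = 1 reads (1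
-- - x z) ∂F/∂z - D F = (1 + x z) F, and a factor z on both sides replaces ∂/∂z by the
-- degree-preserving z ∂/∂z. The combinatorial obstacle is that insertion does not close on objects
-- whose second statistic f is 0: an object with one fixed point (or one succession) may lose it and
-- enter the sum. The proof therefore carries the whole joint distribution, as a functional on test
-- functions φ(e, f), and lets insertion act on φ. The objects with f = 1 are then eliminated by a
-- commutation relation alone: it shows that they contribute n times the sum for size n - 1, which
-- is the origin of the term n x g(n - 1). Size n means words of length n + 1 on the succession
-- side; the additional copy is the insertion of the new letter at the very end.

-- A ring solver with integer coefficients over any commutative ring

module IntegerSolver {c ℓ} (R : CommutativeRing c ℓ) where
  open CommutativeRing R
  open RingProperties ring
  open SemiringMult′ semiring
  open SetoidReasoning setoid

  -- The optimised multiple reduces `1 × 1#` to `1#`, so the solver constant `:1` denotes `1#` on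
  -- the nose.
  ⟦_⟧ℤ : ℤ.ℤ → Carrier
  ⟦ ℤ.+ n ⟧ℤ      = n × 1#
  ⟦ ℤ.-[1+ n ] ⟧ℤ = - (suc n × 1#)

  -‿homo : ∀ i → ⟦ ℤ.- i ⟧ℤ ≈ - ⟦ i ⟧ℤ
  -‿homo (ℤ.+ zero)   = sym -0#≈0#
  -‿homo (ℤ.+ suc n)  = refl
  -‿homo ℤ.-[1+ n ]   = sym (-‿involutive _)

  1+-cancel : ∀ a b → (1# + a) + - (1# + b) ≈ a + - b
  1+-cancel a b = begin
    (1# + a) + - (1# + b)    ≈⟨ +-congˡ (-‿+-comm 1# b) ⟨
    (1# + a) + (- 1# + - b)  ≈⟨ +-congʳ (+-comm 1# a) ⟩
    (a + 1#) + (- 1# + - b)  ≈⟨ +-assoc a 1# _ ⟩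
    a + (1# + (- 1# + - b))  ≈⟨ +-congˡ (+-assoc 1# _ _) ⟨
    a + (1# + - 1# + - b)    ≈⟨ +-congˡ (+-congʳ (-‿inverseʳ 1#)) ⟩
    a + (0# + - b)           ≈⟨ +-congˡ (+-identityˡ _) ⟩
    a + - b                  ∎

  ⊖-homo : ∀ m n → ⟦ m ℤ.⊖ n ⟧ℤ ≈ m × 1# + - (n × 1#)
  ⊖-homo m       zero    = sym (trans (+-congˡ -0#≈0#) (+-identityʳ _))
  ⊖-homo zero    (suc n) = sym (+-identityˡ _)
  ⊖-homo (suc m) (suc n) = begin
    ⟦ suc m ℤ.⊖ suc n ⟧ℤ            ≡⟨ ≡.cong ⟦_⟧ℤ (ℤ.[1+m]⊖[1+n]≡m⊖n m n) ⟩
    ⟦ m ℤ.⊖ n ⟧ℤ                    ≈⟨ ⊖-homo m n ⟩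
    m × 1# + - (n × 1#)             ≈⟨ 1+-cancel _ _ ⟨
    (1# + m × 1#) + - (1# + n × 1#) ≈⟨ +-cong (1+× m 1#) (-‿cong (1+× n 1#)) ⟨
    suc m × 1# + - (suc n × 1#)     ∎

  +-homo : ∀ i j → ⟦ i ℤ.+ j ⟧ℤ ≈ ⟦ i ⟧ℤ + ⟦ j ⟧ℤ
  +-homo (ℤ.+ m)     (ℤ.+ n)    = ×-homo-+ 1# m n
  +-homo (ℤ.+ m)     ℤ.-[1+ n ] = ⊖-homo m (suc n)
  +-homo ℤ.-[1+ m ]  (ℤ.+ n)    = trans (⊖-homo n (suc m)) (+-comm _ _)
  +-homo ℤ.-[1+ m ]  ℤ.-[1+ n ] = begin
    - (suc (suc (m ℕ.+ n)) × 1#)        ≡⟨ ≡.cong (λ k → - (k × 1#)) (≡.cong suc (≡.sym (ℕ.+-suc m n))) ⟩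
    - ((suc m ℕ.+ suc n) × 1#)          ≈⟨ -‿cong (×-homo-+ 1# (suc m) (suc n)) ⟩
    - (suc m × 1# + suc n × 1#)         ≈⟨ -‿+-comm _ _ ⟨
    - (suc m × 1#) + - (suc n × 1#)     ∎

  *-homo⁺ : ∀ m j → ⟦ ℤ.+ m ℤ.* j ⟧ℤ ≈ m × 1# * ⟦ j ⟧ℤ
  *-homo⁺ m (ℤ.+ n) = begin
    ⟦ ℤ.+ m ℤ.* ℤ.+ n ⟧ℤ  ≡⟨ ≡.cong ⟦_⟧ℤ (ℤ.pos-* m n) ⟨
    (m ℕ.* n) × 1#        ≈⟨ ×1-homo-* m n ⟩
    m × 1# * n × 1#       ∎
  *-homo⁺ m ℤ.-[1+ n ] = begin
    ⟦ ℤ.+ m ℤ.* ℤ.-[1+ n ] ⟧ℤ      ≡⟨ ≡.cong ⟦_⟧ℤ (ℤ.neg-distribʳ-* (ℤ.+ m) (ℤ.+ suc n)) ⟨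
    ⟦ ℤ.- (ℤ.+ m ℤ.* ℤ.+ suc n) ⟧ℤ ≈⟨ -‿homo (ℤ.+ m ℤ.* ℤ.+ suc n) ⟩
    - ⟦ ℤ.+ m ℤ.* ℤ.+ suc n ⟧ℤ     ≈⟨ -‿cong (*-homo⁺ m (ℤ.+ suc n)) ⟩
    - (m × 1# * suc n × 1#)        ≈⟨ -‿distribʳ-* _ _ ⟩
    m × 1# * - (suc n × 1#)        ∎

  *-homo : ∀ i j → ⟦ i ℤ.* j ⟧ℤ ≈ ⟦ i ⟧ℤ * ⟦ j ⟧ℤ
  *-homo (ℤ.+ m)    j = *-homo⁺ m j
  *-homo ℤ.-[1+ m ] j = begin
    ⟦ ℤ.-[1+ m ] ℤ.* j ⟧ℤ          ≡⟨ ≡.cong ⟦_⟧ℤ (ℤ.neg-distribˡ-* (ℤ.+ suc m) j) ⟨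
    ⟦ ℤ.- (ℤ.+ suc m ℤ.* j) ⟧ℤ     ≈⟨ -‿homo (ℤ.+ suc m ℤ.* j) ⟩
    - ⟦ ℤ.+ suc m ℤ.* j ⟧ℤ         ≈⟨ -‿cong (*-homo⁺ (suc m) j) ⟩
    - (suc m × 1# * ⟦ j ⟧ℤ)        ≈⟨ -‿distribˡ-* _ _ ⟩
    - (suc m × 1#) * ⟦ j ⟧ℤ        ∎

  ℤ⟶R : ℤ.+-*-rawRing -Raw-AlmostCommutative⟶ fromCommutativeRing R
  ℤ⟶R = record
    { ⟦_⟧    = ⟦_⟧ℤ
    ; +-homo = +-homo
    ; *-homo = *-homo
    ; -‿homo = -‿homo
    ; 0-homo = refl
    ; 1-homo = refl
    }

  -- Distinct integers may have equal images in `R`, so a failed comparison gives `nothing`, not a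
  -- refutation.
  ≟-weak : ∀ i j → Maybe (⟦ i ⟧ℤ ≈ ⟦ j ⟧ℤ)
  ≟-weak i j with i ℤ.≟ j
  ... | yes i≡j = just (reflexive (≡.cong ⟦_⟧ℤ i≡j))
  ... | no  _   = nothing

  open RingSolver ℤ.+-*-rawRing (fromCommutativeRing R) ℤ⟶R ≟-weak public
    using (solve; _:=_; _:+_; _:*_; _:-_; :-_; con; Polynomial)

  :0 :1 : ∀ {n} → Polynomial n
  :0 = con ℤ.0ℤ
  :1 = con ℤ.1ℤ

-- Formal power series as a commutative ring

module SeriesRing {c ℓ} (R : CommutativeRing c ℓ) where
  open CommutativeRing R
  open IntegerSolver R
  open SetoidReasoning setoid
  open Series rawRing

  infix 4 _≋_
  _≋_ : Series → Series → Set ℓ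
  f ≋ g = ∀ n → f n ≈ g n

  ·-cong : ∀ {f f′ g g′} → f ≋ f′ → g ≋ g′ → f · g ≋ f′ · g′
  ·-cong p q zero    = *-cong (p 0) (q 0)
  ·-cong p q (suc n) = +-cong (*-cong (p 0) (q (suc n))) (·-cong (p ∘ suc) q n)

  ·-distribʳ : ∀ f g h → (λ n → g n + h n) · f ≋ (λ n → (g · f) n + (h · f) n)
  ·-distribʳ f g h zero    = distribʳ _ _ _
  ·-distribʳ f g h (suc n) = begin
    (g 0 + h 0) * f (suc n) + ((λ k → g (suc k) + h (suc k)) · f) n
      ≈⟨ +-congˡ (·-distribʳ f (g ∘ suc) (h ∘ suc) n) ⟩
    (g 0 + h 0) * f (suc n) + (((g ∘ suc) · f) n + ((h ∘ suc) · f) n)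
      ≈⟨ solve 5 (λ a b c d e → (a :+ b) :* c :+ (d :+ e) := (a :* c :+ d) :+ (b :* c :+ e)) refl _ _ _ _ _ ⟩
    (g · f) (suc n) + (h · f) (suc n) ∎

  ·-scaleˡ : ∀ a f g → (λ n → a * f n) · g ≋ (λ n → a * (f · g) n)
  ·-scaleˡ a f g zero    = *-assoc _ _ _
  ·-scaleˡ a f g (suc n) = begin
    a * f 0 * g (suc n) + ((λ k → a * f (suc k)) · g) n
      ≈⟨ +-congˡ (·-scaleˡ a (f ∘ suc) g n) ⟩
    a * f 0 * g (suc n) + a * ((f ∘ suc) · g) n
      ≈⟨ solve 4 (λ a b c d → a :* b :* c :+ a :* d := a :* (b :* c :+ d)) refl _ _ _ _ ⟩
    a * (f · g) (suc n) ∎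

  -- By definition `(f · g) ∘ suc` is `f 0` times `g ∘ suc` plus `(f ∘ suc) · g`; distributivity and
  -- scaling split the product with `h` accordingly, and the induction hypothesis applies to
  -- `f ∘ suc`.
  ·-assoc : ∀ f g h → (f · g) · h ≋ f · (g · h)
  ·-assoc f g h zero    = *-assoc _ _ _
  ·-assoc f g h (suc n) = begin
    f 0 * g 0 * h (suc n) + ((λ k → f 0 * g (suc k) + ((f ∘ suc) · g) k) · h) n
      ≈⟨ +-congˡ (·-distribʳ h (λ k → f 0 * g (suc k)) ((f ∘ suc) · g) n) ⟩
    f 0 * g 0 * h (suc n) + (((λ k → f 0 * g (suc k)) · h) n + (((f ∘ suc) · g) · h) n)
      ≈⟨ +-congˡ (+-cong (·-scaleˡ (f 0) (g ∘ suc) h n) (·-assoc (f ∘ suc) g h n)) ⟩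
    f 0 * g 0 * h (suc n) + (f 0 * ((g ∘ suc) · h) n + ((f ∘ suc) · (g · h)) n)
      ≈⟨ solve 5 (λ a b c d e → a :* b :* c :+ (a :* d :+ e) := a :* (b :* c :+ d) :+ e) refl _ _ _ _ _ ⟩
    (f · (g · h)) (suc n) ∎

  -- The definition of `_·_` peels coefficients off the left factor. Commutativity needs the mirror
  -- image, which peels the right one.
  ·-unfoldʳ : ∀ f g n → (f · g) (suc n) ≈ (f · (g ∘ suc)) n + f (suc n) * g 0
  ·-unfoldʳ f g zero    = refl
  ·-unfoldʳ f g (suc n) = begin
    f 0 * g (suc (suc n)) + ((f ∘ suc) · g) (suc n)
      ≈⟨ +-congˡ (·-unfoldʳ (f ∘ suc) g n) ⟩
    f 0 * g (suc (suc n)) + (((f ∘ suc) · (g ∘ suc)) n + f (suc (suc n)) * g 0)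
      ≈⟨ +-assoc _ _ _ ⟨
    (f · (g ∘ suc)) (suc n) + f (suc (suc n)) * g 0 ∎

  ·-comm : ∀ f g → f · g ≋ g · f
  ·-comm f g zero    = *-comm _ _
  ·-comm f g (suc n) = begin
    f 0 * g (suc n) + ((f ∘ suc) · g) n  ≈⟨ +-cong (*-comm _ _) (·-comm (f ∘ suc) g n) ⟩
    g (suc n) * f 0 + (g · (f ∘ suc)) n  ≈⟨ +-comm _ _ ⟩
    (g · (f ∘ suc)) n + g (suc n) * f 0  ≈⟨ ·-unfoldʳ g f n ⟨
    (g · f) (suc n) ∎

  ·-zeroˡ : ∀ {f} g → (∀ n → f n ≈ 0#) → ∀ n → (f · g) n ≈ 0#
  ·-zeroˡ g f≈0 zero    = trans (*-congʳ (f≈0 0)) (zeroˡ _)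
  ·-zeroˡ g f≈0 (suc n) = begin
    _        ≈⟨ +-cong (trans (*-congʳ (f≈0 0)) (zeroˡ _)) (·-zeroˡ g (f≈0 ∘ suc) n) ⟩
    0# + 0#  ≈⟨ +-identityˡ 0# ⟩
    0#       ∎

  const-· : ∀ a f → const a · f ≋ (λ n → a * f n)
  const-· a f zero    = refl
  const-· a f (suc n) = trans (+-congˡ (·-zeroˡ f (λ _ → refl) n)) (+-identityʳ _)

  ·-identityˡ : ∀ f → const 1# · f ≋ f
  ·-identityˡ f n = trans (const-· 1# f n) (*-identityˡ _)

  var-·-suc : ∀ f n → (var · f) (suc n) ≈ f n
  var-·-suc f n = begin
    0# * f (suc n) + ((var ∘ suc) · f) n  ≈⟨ +-cong (zeroˡ _) (·-cong var∘suc (λ _ → refl) n) ⟩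
    0# + (const 1# · f) n                 ≈⟨ +-identityˡ _ ⟩
    (const 1# · f) n                      ≈⟨ ·-identityˡ f n ⟩
    f n                                   ∎
    where
    var∘suc : var ∘ suc ≋ const 1#
    var∘suc zero    = refl
    var∘suc (suc _) = refl

  const-0# : ∀ n → const 0# n ≈ 0#
  const-0# zero    = refl
  const-0# (suc _) = refl

  commutativeRing : CommutativeRing c ℓ
  commutativeRing = record
    { isCommutativeRing = record
      { isRing = record
        { +-isAbelianGroup = record
          { isGroup = record
            { isMonoid = record
              { isSemigroup = record
                { isMagma = record
                  { isEquivalence = record
                    { refl  = λ _ → refl
                    ; sym   = λ p n → sym (p n)
                    ; trans = λ p q n → trans (p n) (q n)
                    }
                  ; ∙-cong = λ p q n → +-cong (p n) (q n)
                  }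
                ; assoc = λ f g h n → +-assoc _ _ _
                }
              ; identity = (λ f n → trans (+-congʳ (const-0# n)) (+-identityˡ _))
                         , (λ f n → trans (+-congˡ (const-0# n)) (+-identityʳ _))
              }
            ; inverse = (λ f n → trans (-‿inverseˡ _) (sym (const-0# n)))
                      , (λ f n → trans (-‿inverseʳ _) (sym (const-0# n)))
            ; ⁻¹-cong = λ p n → -‿cong (p n)
            }
          ; comm = λ f g n → +-comm _ _
          }
        ; *-cong     = ·-cong
        ; *-assoc    = ·-assoc
        ; *-identity = ·-identityˡ , λ f n → trans (·-comm f (const 1#) n) (·-identityˡ f n)
        ; distrib    = (λ f g h n → trans (·-comm f _ n)
                         (trans (·-distribʳ f g h n) (+-cong (·-comm g f n) (·-comm h f n))))
                     , ·-distribʳ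
        }
      ; *-comm = ·-comm
      }
    }

  -- The vector lists the coefficients from degree `n` down to 0, so pairing it with `h` from the
  -- front is the Cauchy product, and its tail follows the recursion of `_·_`.
  ·-dot : ∀ u f h n → (h · inverse u f) n ≈ dot h (inverseCoeffs u f n)
  ·-dot u f h zero    = sym (+-identityʳ _)
  ·-dot u f h (suc n) = +-congˡ (·-dot u f (h ∘ suc) n)

  ·-inverse : ∀ u f → f 0 * u ≈ 1# → f · inverse u f ≋ const 1#
  ·-inverse u f f₀u≈1 zero    = f₀u≈1
  ·-inverse u f f₀u≈1 (suc n) = begin
    f 0 * - (u * s) + ((f ∘ suc) · inverse u f) n  ≈⟨ +-congˡ (·-dot u f (f ∘ suc) n) ⟩
    f 0 * - (u * s) + s
      ≈⟨ solve 3 (λ a u s → a :* (:- (u :* s)) :+ s := (:1 :- a :* u) :* s) refl _ _ _ ⟩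
    (1# - f 0 * u) * s  ≈⟨ *-congʳ (+-congˡ (-‿cong f₀u≈1)) ⟩
    (1# - 1#) * s       ≈⟨ solve 1 (λ s → (:1 :- :1) :* s := :0) refl s ⟩
    0#                  ∎
    where s = dot (f ∘ suc) (inverseCoeffs u f n)

-- Derivations of rings and of power series

record Derivation {c ℓ} (R : CommutativeRing c ℓ) : Set (c ⊔ ℓ) where
  open CommutativeRing R
  field
    D       : Carrier → Carrier
    D-cong  : ∀ {a b} → a ≈ b → D a ≈ D b
    D-+     : ∀ a b → D (a + b) ≈ D a + D b
    D-*     : ∀ a b → D (a * b) ≈ D a * b + a * D b

module Natural {c ℓ} (R : CommutativeRing c ℓ) where
  open CommutativeRing R
  open RawSemiringDefs (RawRing.rawSemiring rawRing) using (_×_)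

  -- This multiple is the plain one: `ν (suc n)` unfolds to `1# + ν n` and `ν 1` to `1# + 0#`, hence
  -- the patterns `:1 :+ k` and `:1 :+ :0` in the solver calls.
  ν : ℕ → Carrier
  ν n = n × 1#

module DerivationProperties {c ℓ} {R : CommutativeRing c ℓ} (∂ : Derivation R) where
  open CommutativeRing R
  open RingProperties ring using (x+x≈x⇒x≈0)
  open IntegerSolver R
  open Natural R
  open RawSemiringDefs (RawRing.rawSemiring rawRing) using (_^_)
  open Derivation ∂
  open SetoidReasoning setoid

  D-0 : D 0# ≈ 0#
  D-0 = x+x≈x⇒x≈0 (D 0#) (trans (sym (D-+ 0# 0#)) (D-cong (+-identityˡ 0#)))

  D-1 : D 1# ≈ 0#
  D-1 = x+x≈x⇒x≈0 (D 1#) (begin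
    D 1# + D 1#            ≈⟨ solve 1 (λ d → d :+ d := d :* :1 :+ :1 :* d) refl _ ⟩
    D 1# * 1# + 1# * D 1#  ≈⟨ D-* 1# 1# ⟨
    D (1# * 1#)            ≈⟨ D-cong (*-identityˡ 1#) ⟩
    D 1#                   ∎)

  D-neg : ∀ a → D (- a) ≈ - D a
  D-neg a = begin
    D (- a)                  ≈⟨ solve 2 (λ u v → u := (u :+ v) :- v) refl _ (D a) ⟩
    (D (- a) + D a) - D a    ≈⟨ +-congʳ (D-+ (- a) a) ⟨
    D (- a + a) - D a        ≈⟨ +-congʳ (trans (D-cong (-‿inverseˡ a)) D-0) ⟩
    0# - D a                 ≈⟨ +-identityˡ _ ⟩
    - D a                    ∎

  D-constant-* : ∀ k a → D k ≈ 0# → D (k * a) ≈ k * D a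
  D-constant-* k a Dk≈0 = begin
    D (k * a)          ≈⟨ D-* k a ⟩
    D k * a + k * D a  ≈⟨ +-congʳ (*-congʳ Dk≈0) ⟩
    0# * a + k * D a   ≈⟨ solve 2 (λ a b → :0 :* a :+ b := b) refl _ _ ⟩
    k * D a            ∎

  D-^ : ∀ a n → D (a ^ suc n) ≈ ν (suc n) * (a ^ n * D a)
  D-^ a zero    = trans (D-cong (*-identityʳ a))
    (solve 1 (λ d → d := (:1 :+ :0) :* (:1 :* d)) refl (D a))
  D-^ a (suc n) = begin
    D (a * a ^ suc n)                                ≈⟨ D-* a (a ^ suc n) ⟩
    D a * a ^ suc n + a * D (a ^ suc n)              ≈⟨ +-congˡ (*-congˡ (D-^ a n)) ⟩
    D a * (a * a ^ n) + a * (ν (suc n) * (a ^ n * D a))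
      ≈⟨ solve 4 (λ a d p k → d :* (a :* p) :+ a :* (k :* (p :* d)) := (:1 :+ k) :* ((a :* p) :* d)) refl _ _ _ _ ⟩
    ν (suc (suc n)) * (a ^ suc n * D a)              ∎

open Product using (_×_)

module _ {c ℓ} {R : CommutativeRing c ℓ} where
  open CommutativeRing R
  open IntegerSolver R

  infixr 7 _•_
  -- Derivations form a module over the ring, so the Leibniz rule for a combination such as `Δ`
  -- reduces to that of its two summands.
  _•_ : Carrier → Derivation R → Derivation R
  k • ∂ = record
    { D      = λ a → k * D a
    ; D-cong = λ a≈b → *-congˡ (D-cong a≈b)
    ; D-+    = λ a b → trans (*-congˡ (D-+ a b)) (distribˡ k _ _)
    ; D-*    = λ a b → trans (*-congˡ (D-* a b))
        (solve 5 (λ k a b a′ b′ → k :* (a′ :* b :+ a :* b′) := k :* a′ :* b :+ a :* (k :* b′)) refl k a b _ _)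
    }
    where open Derivation ∂

  infixl 6 _⊕_
  _⊕_ : Derivation R → Derivation R → Derivation R
  ∂₁ ⊕ ∂₂ = record
    { D      = λ a → D₁.D a + D₂.D a
    ; D-cong = λ a≈b → +-cong (D₁.D-cong a≈b) (D₂.D-cong a≈b)
    ; D-+    = λ a b → trans (+-cong (D₁.D-+ a b) (D₂.D-+ a b))
        (solve 4 (λ a b a′ b′ → a :+ b :+ (a′ :+ b′) := a :+ a′ :+ (b :+ b′)) refl _ _ _ _)
    ; D-*    = λ a b → trans (+-cong (D₁.D-* a b) (D₂.D-* a b))
        (solve 6 (λ a b a₁ b₁ a₂ b₂ → a₁ :* b :+ a :* b₁ :+ (a₂ :* b :+ a :* b₂)
            := (a₁ :+ a₂) :* b :+ a :* (b₁ :+ b₂)) refl a b _ _ _ _)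
    }
    where
    module D₁ = Derivation ∂₁
    module D₂ = Derivation ∂₂

module SeriesDerivations {c ℓ} (R : CommutativeRing c ℓ) where
  open CommutativeRing R
  open IntegerSolver R
  open Natural R
  open SetoidReasoning setoid
  open Series rawRing
  open SeriesRing R

  -- The operator t d/dt, which unlike d/dt shifts no index. It serves twice: in the variable x, to
  -- build `D` as (1 - x) times it, and in z, to build `Δ`.
  euler : Series → Series
  euler f n = ν n * f n

  euler-· : ∀ f g → euler (f · g) ≋ (λ n → (euler f · g) n + (f · euler g) n)
  euler-· f g zero    = solve 2 (λ a b → :0 :* (a :* b) := :0 :* a :* b :+ a :* (:0 :* b)) refl _ _
  euler-· f g (suc n) = begin
    ν (suc n) * (f 0 * g (suc n) + (f′ · g) n)
      ≈⟨ solve 4 (λ k a b p → (:1 :+ k) :* (a :* b :+ p)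
           := :0 :* a :* b :+ (a :* ((:1 :+ k) :* b) :+ (p :+ k :* p))) refl _ _ _ _ ⟩
    0# * f 0 * g (suc n) + (f 0 * (ν (suc n) * g (suc n)) + ((f′ · g) n + ν n * (f′ · g) n))
      ≈⟨ +-congˡ (+-congˡ (+-congˡ (euler-· f′ g n))) ⟩
    0# * f 0 * g (suc n) + (f 0 * (ν (suc n) * g (suc n)) + ((f′ · g) n + ((euler f′ · g) n + (f′ · euler g) n)))
      ≈⟨ solve 5 (λ z y p q r → z :+ (y :+ (p :+ (q :+ r))) := (z :+ (p :+ q)) :+ (y :+ r)) refl _ _ _ _ _ ⟩
    0# * f 0 * g (suc n) + ((f′ · g) n + (euler f′ · g) n) + (f · euler g) (suc n)
      ≈⟨ +-congʳ (+-congˡ (·-distribʳ g f′ (euler f′) n)) ⟨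
    0# * f 0 * g (suc n) + ((λ k → f′ k + euler f′ k) · g) n + (f · euler g) (suc n)
      ≈⟨ +-congʳ (+-congˡ (·-cong (λ k → solve 2 (λ a k → a :+ k :* a := (:1 :+ k) :* a) refl (f′ k) (ν k)) (λ _ → refl) n)) ⟩
    (euler f · g) (suc n) + (f · euler g) (suc n) ∎
    where f′ = f ∘ suc

  eulerDerivation : Derivation commutativeRing
  eulerDerivation = record
    { D      = euler
    ; D-cong = λ p n → *-congˡ (p n)
    ; D-+    = λ f g n → distribˡ _ _ _
    ; D-*    = euler-·
    }

  module _ (∂ : Derivation R) where
    open Derivation ∂
    open DerivationProperties ∂

    coefficientwise-· : ∀ f g → D ∘ (f · g) ≋ (λ n → ((D ∘ f) · g) n + (f · (D ∘ g)) n)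
    coefficientwise-· f g zero    = D-* _ _
    coefficientwise-· f g (suc n) = begin
      D (f 0 * g (suc n) + (f′ · g) n)
        ≈⟨ D-+ _ _ ⟩
      D (f 0 * g (suc n)) + D ((f′ · g) n)
        ≈⟨ +-cong (D-* _ _) (coefficientwise-· f′ g n) ⟩
      (D (f 0) * g (suc n) + f 0 * D (g (suc n))) + (((D ∘ f′) · g) n + (f′ · (D ∘ g)) n)
        ≈⟨ solve 4 (λ a b p q → (a :+ b) :+ (p :+ q) := (a :+ p) :+ (b :+ q)) refl _ _ _ _ ⟩
      ((D ∘ f) · g) (suc n) + (f · (D ∘ g)) (suc n) ∎
      where f′ = f ∘ suc

    coefficientwise : Derivation commutativeRing
    coefficientwise = record
      { D      = λ f → D ∘ f
      ; D-cong = λ p n → D-cong (p n)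
      ; D-+    = λ f g n → D-+ _ _
      ; D-*    = coefficientwise-·
      }

    coefficientwise-const : ∀ a → D ∘ const a ≋ const (D a)
    coefficientwise-const a zero    = refl
    coefficientwise-const a (suc n) = D-0

  euler-const : ∀ a → euler (const a) ≋ const 0#
  euler-const a zero    = zeroˡ a
  euler-const a (suc n) = zeroʳ _

  euler-var : euler var ≋ var
  euler-var zero          = zeroʳ _
  euler-var (suc zero)    = solve 0 ((:1 :+ :0) :* :1 := :1) refl
  euler-var (suc (suc n)) = zeroʳ _

  const-+ : ∀ a b → const (a + b) ≋ (λ n → const a n + const b n)
  const-+ a b zero    = refl
  const-+ a b (suc n) = sym (+-identityˡ 0#)

  const-* : ∀ a b → const (a * b) ≋ const a · const b
  const-* a b n = sym (trans (const-· a (const b) n) (lemma n))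
    where
    lemma : ∀ n → a * const b n ≈ const (a * b) n
    lemma zero    = refl
    lemma (suc n) = zeroʳ a

  const-neg : ∀ a → const (- a) ≋ (λ n → - const a n)
  const-neg a zero    = refl
  const-neg a (suc n) = solve 0 (:0 := :- :0) refl

  const-cong : ∀ {a b} → a ≈ b → const a ≋ const b
  const-cong a≈b zero    = a≈b
  const-cong a≈b (suc n) = refl

-- Logarithmic derivatives

module LogarithmicDerivative {c ℓ} {S : CommutativeRing c ℓ} (Δ : Derivation S) (z : CommutativeRing.Carrier S) where
  open CommutativeRing S
  open IntegerSolver S
  open Derivation Δ
  open DerivationProperties Δ
  open SetoidReasoning setoid

  infix 4 _HasRate_
  -- The rate is the logarithmic derivative divided by `z`, written without division because in the
  -- application `z` is the series variable.
  _HasRate_ : Carrier → Carrier → Set ℓ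
  f HasRate r = D f ≈ z * (r * f)

  rate-cong : ∀ {f r s} → r ≈ s → f HasRate r → f HasRate s
  rate-cong r≈s p = trans p (*-congˡ (*-congʳ r≈s))

  rate-* : ∀ {f g r s} → f HasRate r → g HasRate s → f * g HasRate r + s
  rate-* {f} {g} {r} {s} p q = begin
    D (f * g)                          ≈⟨ D-* f g ⟩
    D f * g + f * D g                  ≈⟨ +-cong (*-congʳ p) (*-congˡ q) ⟩
    z * (r * f) * g + f * (z * (s * g))
      ≈⟨ solve 5 (λ z r s f g → z :* (r :* f) :* g :+ f :* (z :* (s :* g)) := z :* ((r :+ s) :* (f :* g))) refl z r s f g ⟩
    z * ((r + s) * (f * g))            ∎

  -- Logarithmic derivatives are additive on products, not on sums; a difference inherits a rate
  -- here because both terms share it.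
  rate-difference : ∀ {f g r} → f HasRate r → g HasRate r → f + - g HasRate r
  rate-difference {f} {g} {r} p q = begin
    D (f + - g)                    ≈⟨ D-+ f (- g) ⟩
    D f + D (- g)                  ≈⟨ +-cong p (trans (D-neg g) (-‿cong q)) ⟩
    z * (r * f) + - (z * (r * g))
      ≈⟨ solve 4 (λ z r f g → z :* (r :* f) :+ (:- (z :* (r :* g))) := z :* (r :* (f :+ (:- g)))) refl z r f g ⟩
    z * (r * (f + - g))            ∎

  rate-1 : 1# HasRate 0#
  rate-1 = trans D-1 (solve 1 (λ z → :0 := z :* (:0 :* :1)) refl z)

  -- Differentiating `f * g ≈ 1#` gives `D f * g + f * D g ≈ 0#`; one more multiplication by `g`
  -- isolates `D g`, in place of a cancellation of `f`.
  rate-inverse : ∀ {f g r} → f * g ≈ 1# → f HasRate r → g HasRate - r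
  rate-inverse {f} {g} {r} fg≈1 p = begin
    D g
      ≈⟨ *-identityˡ (D g) ⟨
    1# * D g
      ≈⟨ *-congʳ fg≈1 ⟨
    f * g * D g
      ≈⟨ solve 4 (λ f g d e → f :* g :* d := (e :* g :+ f :* d) :* g :- e :* g :* g) refl f g (D g) (D f) ⟩
    (D f * g + f * D g) * g - D f * g * g
      ≈⟨ +-cong (*-congʳ (trans (sym (D-* f g)) (trans (D-cong fg≈1) D-1)))
                (-‿cong (*-congʳ (*-congʳ p))) ⟩
    0# * g - z * (r * f) * g * g
      ≈⟨ solve 4 (λ z r f g → :0 :* g :- z :* (r :* f) :* g :* g := :- (z :* (r :* (f :* g :* g)))) refl z r f g ⟩
    - (z * (r * (f * g * g)))
      ≈⟨ -‿cong (*-congˡ (*-congˡ (*-congʳ fg≈1))) ⟩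
    - (z * (r * (1# * g)))
      ≈⟨ solve 3 (λ z r g → :- (z :* (r :* (:1 :* g))) := z :* ((:- r) :* g)) refl z r g ⟩
    z * (- r * g) ∎

-- The exponential generating function and its rate

-- Behind this interface 1/n!, ½ and 1/(1 - x) are known only by their defining equations, so no
-- rational arithmetic enters the argument about the series.
record EgfData {c ℓ} {R : CommutativeRing c ℓ} (∂ : Derivation R) : Set (c ⊔ ℓ) where
  open CommutativeRing R
  open Derivation ∂
  open Natural R
  field
    1/_!     : ℕ → Carrier
    1/0!     : 1/ 0 ! ≈ 1#
    1/suc!   : ∀ n → ν (suc n) * 1/ suc n ! ≈ 1/ n !
    D-1/!    : ∀ n → D (1/ n !) ≈ 0#
    ½        : Carrier
    ½+½      : ½ + ½ ≈ 1#
    D-½      : D ½ ≈ 0#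
    x        : Carrier
    D-x      : D x ≈ x * (1# + - x)
    u        : Carrier
    1-x*u    : (1# + - x) * u ≈ 1#

module Exponential {c ℓ} {R : CommutativeRing c ℓ} {∂ : Derivation R} (𝓔 : EgfData ∂) where
  open CommutativeRing R
  open IntegerSolver R
  open Natural R
  open Derivation ∂
  open DerivationProperties ∂
  open RawSemiringDefs (RawRing.rawSemiring rawRing) using (_^_)
  open Series rawRing using (const; var; _·_) renaming (Series to Ser)
  open SeriesRing R
  open SeriesDerivations R
  open EgfData 𝓔
  open SetoidReasoning setoid

  exp : Carrier → Ser
  exp a n = 1/ n ! * a ^ n

  euler-exp : ∀ a → euler (exp a) ≋ var · (const a · exp a)
  euler-exp a zero    = solve 2 (λ p q → :0 :* p := :0 :* q) refl _ _
  euler-exp a (suc n) = begin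
    ν (suc n) * (1/ suc n ! * (a * a ^ n))
      ≈⟨ solve 4 (λ k j a p → k :* (j :* (a :* p)) := a :* (k :* j :* p)) refl _ _ _ _ ⟩
    a * (ν (suc n) * 1/ suc n ! * a ^ n)  ≈⟨ *-congˡ (*-congʳ (1/suc! n)) ⟩
    a * exp a n                          ≈⟨ const-· a (exp a) n ⟨
    (const a · exp a) n                  ≈⟨ var-·-suc (const a · exp a) n ⟨
    (var · (const a · exp a)) (suc n)      ∎

  -- The chain rule for e^(a z): the coefficient derivation treats z as a constant, so the exponent
  -- contributes z times `D a`. The factor `var` here and in `euler-exp` is the `z` of `_HasRate_`.
  D-exp : ∀ a → D ∘ exp a ≋ var · (const (D a) · exp a)
  D-exp a zero    = begin
    D (1/ 0 ! * 1#)  ≈⟨ D-constant-* (1/ 0 !) 1# (D-1/! 0) ⟩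
    1/ 0 ! * D 1#    ≈⟨ *-congˡ D-1 ⟩
    1/ 0 ! * 0#      ≈⟨ solve 2 (λ p q → p :* :0 := :0 :* q) refl _ _ ⟩
    0# * (const (D a) · exp a) 0 ∎
  D-exp a (suc n) = begin
    D (1/ suc n ! * a ^ suc n)
      ≈⟨ D-constant-* _ _ (D-1/! (suc n)) ⟩
    1/ suc n ! * D (a ^ suc n)
      ≈⟨ *-congˡ (D-^ a n) ⟩
    1/ suc n ! * (ν (suc n) * (a ^ n * D a))
      ≈⟨ solve 4 (λ k j d p → j :* (k :* (p :* d)) := d :* (k :* j :* p)) refl _ _ _ _ ⟩
    D a * (ν (suc n) * 1/ suc n ! * a ^ n)  ≈⟨ *-congˡ (*-congʳ (1/suc! n)) ⟩
    D a * exp a n                          ≈⟨ const-· (D a) (exp a) n ⟨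
    (const (D a) · exp a) n                ≈⟨ var-·-suc (const (D a) · exp a) n ⟨
    (var · (const (D a) · exp a)) (suc n)    ∎

module GeneratingFunction {c ℓ} {R : CommutativeRing c ℓ} {∂ : Derivation R} (𝓔 : EgfData ∂) where
  private
    module K = CommutativeRing R
    module KS = IntegerSolver R
    module N = Natural R
  open Derivation ∂ using (D; D-+)
  open DerivationProperties ∂ using (D-1; D-neg)
  open Series K.rawRing using (const; var; inverse) renaming (Series to Ser)
  open SeriesRing R
  open SeriesDerivations R
  open Exponential 𝓔
  open EgfData 𝓔
  open CommutativeRing commutativeRing
  open RawSemiringDefs (RawRing.rawSemiring rawRing) using (_^_)
  open IntegerSolver commutativeRing
  open SetoidReasoning setoid

  X Z : Ser
  X = const x
  Z = var

  Δ : Derivation commutativeRing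
  Δ = (1# + - (X * Z)) • eulerDerivation ⊕ (- Z) • coefficientwise ∂

  open LogarithmicDerivative Δ Z

  rate-exp : ∀ a b → D a K.≈ b → exp a HasRate ((1# + - (X * Z)) * const a + - (Z * const b))
  rate-exp a b Da≈b = begin
    (1# + - (X * Z)) * euler (exp a) + - Z * (D ∘ exp a)
      ≈⟨ +-cong (*-congˡ (euler-exp a)) (*-congˡ (trans (D-exp a) (*-congˡ {Z} (*-congʳ (const-cong Da≈b))))) ⟩
    (1# + - (X * Z)) * (Z * (const a * exp a)) + - Z * (Z * (const b * exp a))
      ≈⟨ solve 5 (λ x z a b e → (:1 :+ (:- (x :* z))) :* (z :* (a :* e)) :+ (:- z) :* (z :* (b :* e))
           := z :* (((:1 :+ (:- (x :* z))) :* a :+ (:- (z :* b))) :* e)) refl X Z (const a) (const b) (exp a) ⟩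
    Z * (((1# + - (X * Z)) * const a + - (Z * const b)) * exp a) ∎

  -- On a series constant in z only the summand `(- Z) • coefficientwise ∂` acts, so the rate is
  -- minus the logarithmic derivative of `a` under `D`.
  rate-const : ∀ a b → D a K.≈ K.- b K.* a → const a HasRate const b
  rate-const a b Da≈-ba = begin
    (1# + - (X * Z)) * euler (const a) + - Z * (D ∘ const a)
      ≈⟨ +-cong (*-congˡ {1# + - (X * Z)} (euler-const a)) (*-congˡ { - Z} (trans (coefficientwise-const ∂ a) (const-cong Da≈-ba))) ⟩
    (1# + - (X * Z)) * 0# + - Z * const (K.- b K.* a)
      ≈⟨ +-congˡ (*-congˡ { - Z} (trans (const-* (K.- b) a) (*-congʳ (const-neg b)))) ⟩
    (1# + - (X * Z)) * 0# + - Z * (- const b * const a)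
      ≈⟨ solve 4 (λ w z a b → w :* :0 :+ (:- z) :* ((:- b) :* a) := z :* (b :* a)) refl (1# + - (X * Z)) Z (const a) (const b) ⟩
    Z * (const b * const a) ∎

  X-1 : const (x K.+ K.- K.1#) ≈ X + - 1#
  X-1 = trans (const-+ x (K.- K.1#)) (+-congˡ (const-neg K.1#))

  rate-X : X HasRate (X + - 1#)
  rate-X = rate-cong X-1 (rate-const x (x K.+ K.- K.1#) (K.trans D-x
    (KS.solve 1 (λ x → x KS.:* (KS.:1 KS.:+ (KS.:- x)) KS.:= (KS.:- (x KS.:+ (KS.:- KS.:1))) KS.:* x) K.refl x)))

  rate-1-x : const (K.1# K.+ K.- x) HasRate X
  rate-1-x = rate-const (K.1# K.+ K.- x) x (K.trans (D-+ K.1# (K.- x)) (K.trans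
    (K.+-cong D-1 (K.trans (D-neg x) (K.-‿cong D-x)))
    (KS.solve 1 (λ x → KS.:0 KS.:+ (KS.:- (x KS.:* (KS.:1 KS.:+ (KS.:- x)))) KS.:= (KS.:- x) KS.:* (KS.:1 KS.:+ (KS.:- x))) K.refl x)))

  den : Ser
  den = exp x + - (X * exp K.1#)

  -- Both terms have the rate x (1 - z): for e^(x z) it is (1 - x z) x - z x (1 - x), for x e^z it
  -- is (x - 1) + (1 - x z). This coincidence is what makes the difference tractable.
  rate-denominator : den HasRate (X * (1# + - Z))
  rate-denominator = rate-difference
    (rate-cong (trans (+-congˡ (-‿cong (*-congˡ {Z} (const-* x (K.1# K.+ K.- x)))))
       (trans (+-congˡ (-‿cong (*-congˡ {Z} (*-congˡ (trans (const-+ K.1# (K.- x)) (+-congˡ (const-neg x)))))))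
       (solve 2 (λ x z → (:1 :+ (:- (x :* z))) :* x :+ (:- (z :* (x :* (:1 :+ (:- x))))) := x :* (:1 :+ (:- z))) refl X Z)))
      (rate-exp x _ D-x))
    (rate-cong
       (solve 2 (λ x z → (x :+ (:- :1)) :+ ((:1 :+ (:- (x :* z))) :* :1 :+ (:- (z :* :0))) := x :* (:1 :+ (:- z))) refl X Z)
      (rate-* {X} {exp K.1#} rate-X (rate-exp K.1# K.0# D-1)))

  -- Spelled so that for the concrete data it unfolds to `dᴮ½-egf`; the recurrence then holds for
  -- `dᴮ½` without any transport.
  egf : Ser
  egf = (const (K.1# K.+ K.- x) * exp ½ * inverse u den) ^ 2

  denominator-0 : den 0 K.* u K.≈ K.1#
  denominator-0 = K.trans (K.*-congʳ (K.+-cong (K.*-congʳ 1/0!) (K.-‿cong (K.*-congˡ (K.*-congʳ 1/0!)))))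
    (K.trans (KS.solve 2 (λ x u → ((KS.:1 KS.:* KS.:1) KS.:+ (KS.:- (x KS.:* (KS.:1 KS.:* KS.:1)))) KS.:* u
        KS.:= (KS.:1 KS.:+ (KS.:- x)) KS.:* u) K.refl x u) 1-x*u)

  egf-0 : egf 0 K.≈ K.1#
  egf-0 = K.trans (K.*-cong root-0 (K.trans (K.*-congʳ root-0) (K.*-identityˡ _))) (K.*-identityˡ _)
    where
    root-0 : (K.1# K.+ K.- x) K.* (1/ 0 ! K.* K.1#) K.* u K.≈ K.1#
    root-0 = K.trans (K.*-congʳ (K.*-congˡ (K.*-congʳ 1/0!)))
      (K.trans (K.*-congʳ (K.trans (K.*-congˡ (K.*-identityˡ _)) (K.*-identityʳ _))) 1-x*u)

  const-½+const-½ : const ½ + const ½ ≈ 1#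
  const-½+const-½ = trans (sym (const-+ ½ ½)) (const-cong ½+½)

  -- The factors of `root` contribute x, (1 - x z)/2 and -x (1 - z), in total (1 + x z)/2, and the
  -- square doubles this. The summand `0#` comes from `_^ 2` unfolding to `root * (root * 1#)`.
  rate-egf : egf HasRate (1# + X * Z)
  rate-egf = rate-cong
    (begin
      r + (r + 0#)
        ≈⟨ solve 3 (λ x z k → (x :+ ((:1 :+ (:- (x :* z))) :* k :+ (:- (z :* :0))) :+ (:- (x :* (:1 :+ (:- z)))))
              :+ ((x :+ ((:1 :+ (:- (x :* z))) :* k :+ (:- (z :* :0))) :+ (:- (x :* (:1 :+ (:- z))))) :+ :0)
            := (k :+ k) :* (:1 :+ (:- (x :* z))) :+ (x :+ x) :* z) refl X Z (const ½) ⟩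
      (const ½ + const ½) * (1# + - (X * Z)) + (X + X) * Z
        ≈⟨ +-congʳ (*-congʳ const-½+const-½) ⟩
      1# * (1# + - (X * Z)) + (X + X) * Z
        ≈⟨ solve 2 (λ x z → :1 :* (:1 :+ (:- (x :* z))) :+ (x :+ x) :* z := :1 :+ x :* z) refl X Z ⟩
      1# + X * Z ∎)
    (rate-* {root} {root * 1#} rate-root (rate-* {root} {1#} rate-root rate-1))
    where
    root = const (K.1# K.+ K.- x) * exp ½ * inverse u den
    r = X + ((1# + - (X * Z)) * const ½ + - (Z * 0#)) + - (X * (1# + - Z))
    rate-root : root HasRate r
    rate-root = rate-* {const (K.1# K.+ K.- x) * exp ½} {inverse u den}
      (rate-* {const (K.1# K.+ K.- x)} {exp ½} rate-1-x (rate-exp ½ K.0# D-½))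
      (rate-inverse {den} (·-inverse u den denominator-0) rate-denominator)

  -- The rate equation solved for z ∂F/∂z. The right side has an overall factor `Z`, so its
  -- coefficient in degree n + 1 involves `egf` only up to degree n.
  euler-egf : euler egf ≈ Z * (X * euler egf + (D ∘ egf) + egf + X * (Z * egf))
  euler-egf = begin
    euler egf
      ≈⟨ solve 4 (λ x z e d → e := ((:1 :+ (:- (x :* z))) :* e :+ (:- z) :* d) :+ z :* (x :* e :+ d)) refl X Z (euler egf) (D ∘ egf) ⟩
    Derivation.D Δ egf + Z * (X * euler egf + (D ∘ egf))
      ≈⟨ +-congʳ rate-egf ⟩
    Z * ((1# + X * Z) * egf) + Z * (X * euler egf + (D ∘ egf))
      ≈⟨ solve 5 (λ x z b e d → z :* ((:1 :+ x :* z) :* b) :+ z :* (x :* e :+ d)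
           := z :* (x :* e :+ d :+ b :+ x :* (z :* b))) refl X Z egf (euler egf) (D ∘ egf) ⟩
    Z * (X * euler egf + (D ∘ egf) + egf + X * (Z * egf)) ∎

  egf-suc : ∀ n → N.ν (suc n) K.* egf (suc n)
            K.≈ x K.* (N.ν n K.* egf n) K.+ D (egf n) K.+ egf n K.+ x K.* (Z * egf) n
  egf-suc n = K.trans (euler-egf (suc n)) (K.trans (var-·-suc _ n)
    (K.+-cong (K.+-congʳ (K.+-congʳ (const-· x (euler egf) n))) (const-· x (Z * egf) n)))

-- The recurrences and their comparison

module Recurrences {c ℓ} {R : CommutativeRing c ℓ} (∂ : Derivation R) (x : CommutativeRing.Carrier R) where
  open CommutativeRing R
  open IntegerSolver R
  open Natural R
  open Derivation ∂
  open SetoidReasoning setoid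

  -- At `n = 0` the last term vanishes with `ν 0`, so the single initial value determines the
  -- sequence although the recurrence has order two.
  record Recurrence (k : Carrier) (g : ℕ → Carrier) : Set ℓ where
    field
      g-zero : g 0 ≈ 1#
      g-suc  : ∀ n → g (suc n) ≈ D (g n) + (ν n * x + k) * g n + ν n * (x * g (pred n))

  open Recurrence

  unique : ∀ {k g h} → Recurrence k g → Recurrence k h → ∀ n → g n ≈ h n
  unique {k} {g} {h} rg rh n = proj₂ (go n)
    where
    -- Order two requires carrying two consecutive equalities; at 0 they coincide because `pred 0`
    -- is 0.
    go : ∀ n → g (pred n) ≈ h (pred n) × g n ≈ h n
    go zero    = let p = trans (g-zero rg) (sym (g-zero rh)) in p , p
    go (suc n) with go n
    ... | p , q = q , (begin
      g (suc n)  ≈⟨ g-suc rg n ⟩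
      _          ≈⟨ +-cong (+-cong (D-cong q) (*-congˡ q)) (*-congˡ (*-congˡ p)) ⟩
      _          ≈⟨ g-suc rh n ⟨
      h (suc n)  ∎)

  -- Both sides satisfy y (n+1) = D (y n) + (n + 1) x (y n) + n x (y (n-1)).
  x*h≈gₙ₊₁+x*gₙ : D x ≈ x * (1# + - x) → ∀ {g h} → Recurrence 0# g → Recurrence 1# h →
                  ∀ n → x * h n ≈ g (suc n) + x * g n
  x*h≈gₙ₊₁+x*gₙ D-x {g} {h} rg rh n = proj₂ (go n)
    where
    y : ℕ → Carrier
    y n = g (suc n) + x * g n

    base : x * h 0 ≈ y 0
    base = begin
      x * h 0                       ≈⟨ *-congˡ (g-zero rh) ⟩
      x * 1#                        ≈⟨ *-congˡ (g-zero rg) ⟨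
      x * g 0                       ≈⟨ solve 2 (λ x g → x :* g := (:0 :+ (:0 :* x :+ :0) :* g :+ :0 :* (x :* g)) :+ x :* g) refl x (g 0) ⟩
      (0# + (0# * x + 0#) * g 0 + 0# * (x * g 0)) + x * g 0
        ≈⟨ +-congʳ (+-congʳ (+-congʳ (trans (D-cong (g-zero rg)) D-1))) ⟨
      (D (g 0) + (0# * x + 0#) * g 0 + 0# * (x * g 0)) + x * g 0
        ≈⟨ +-congʳ (g-suc rg 0) ⟨
      y 0                           ∎
      where open DerivationProperties ∂ using (D-1)

    -- Multiplication by x absorbs k = 1: since D x = x - x², the term x h is (D x) h + x (x h),
    -- whose first half completes D (x h) and whose second half turns k into x.
    lhs : ∀ n → x * h (suc n) ≈ D (x * h n) + (ν n * x + x) * (x * h n) + ν n * (x * (x * h (pred n)))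
    lhs n = begin
      x * h (suc n)
        ≈⟨ *-congˡ (g-suc rh n) ⟩
      x * (D (h n) + (ν n * x + 1#) * h n + ν n * (x * h (pred n)))
        ≈⟨ solve 5 (λ x d k h h′ → x :* (d :+ (k :* x :+ :1) :* h :+ k :* (x :* h′))
              := ((x :* (:1 :+ (:- x))) :* h :+ x :* d) :+ (k :* x :+ x) :* (x :* h) :+ k :* (x :* (x :* h′)))
            refl x (D (h n)) (ν n) (h n) (h (pred n)) ⟩
      ((x * (1# + - x)) * h n + x * D (h n)) + (ν n * x + x) * (x * h n) + ν n * (x * (x * h (pred n)))
        ≈⟨ +-congʳ (+-congʳ (trans (D-* x (h n)) (+-congʳ (*-congʳ D-x)))) ⟨
      D (x * h n) + (ν n * x + x) * (x * h n) + ν n * (x * (x * h (pred n))) ∎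

    -- `y (pred n)` contains `g (suc (pred n))`, which is `g n` only for n ≥ 1; the factor `ν n`
    -- settles n = 0.
    g-suc-pred : ∀ n → ν n * g n ≈ ν n * (g (suc (pred n)))
    g-suc-pred zero    = trans (zeroˡ _) (sym (zeroˡ _))
    g-suc-pred (suc n) = refl

    rhs : ∀ n → y (suc n) ≈ D (y n) + (ν n * x + x) * y n + ν n * (x * y (pred n))
    rhs n = begin
      g (suc (suc n)) + x * g (suc n)
        ≈⟨ +-congʳ (g-suc rg (suc n)) ⟩
      (D (g (suc n)) + (ν (suc n) * x + 0#) * g (suc n) + ν (suc n) * (x * g n)) + x * g (suc n)
        ≈⟨ solve 5 (λ x d k a b → (d :+ ((:1 :+ k) :* x :+ :0) :* a :+ (:1 :+ k) :* (x :* b)) :+ x :* a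
              := (d :+ (k :* x :+ x) :* a :+ (x :* b) :+ x :* (k :* b)) :+ x :* a) refl x (D (g (suc n))) (ν n) (g (suc n)) (g n) ⟩
      (D (g (suc n)) + (ν n * x + x) * g (suc n) + x * g n + x * (ν n * g n)) + x * g (suc n)
        ≈⟨ +-cong (+-congˡ (*-congˡ (g-suc-pred n))) (*-congˡ (g-suc rg n)) ⟩
      (D (g (suc n)) + (ν n * x + x) * g (suc n) + x * g n + x * (ν n * g (suc (pred n))))
        + x * (D (g n) + (ν n * x + 0#) * g n + ν n * (x * g (pred n)))
        ≈⟨ solve 8 (λ x d e k a b b₊ b₋ →
              (d :+ (k :* x :+ x) :* a :+ x :* b :+ x :* (k :* b₊)) :+ x :* (e :+ (k :* x :+ :0) :* b :+ k :* (x :* b₋))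
              := (d :+ ((x :* (:1 :+ (:- x))) :* b :+ x :* e)) :+ (k :* x :+ x) :* (a :+ x :* b) :+ k :* (x :* (b₊ :+ x :* b₋)))
            refl x (D (g (suc n))) (D (g n)) (ν n) (g (suc n)) (g n) (g (suc (pred n))) (g (pred n)) ⟩
      (D (g (suc n)) + ((x * (1# + - x)) * g n + x * D (g n))) + (ν n * x + x) * y n + ν n * (x * y (pred n))
        ≈⟨ +-congʳ (+-congʳ (trans (D-+ (g (suc n)) (x * g n)) (+-congˡ (trans (D-* x (g n)) (+-congʳ (*-congʳ D-x)))))) ⟨
      D (y n) + (ν n * x + x) * y n + ν n * (x * y (pred n)) ∎

    go : ∀ n → x * h (pred n) ≈ y (pred n) × x * h n ≈ y n
    go zero    = base , base
    go (suc n) with go n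
    ... | p , q = q , (begin
      x * h (suc n)  ≈⟨ lhs n ⟩
      _              ≈⟨ +-cong (+-cong (D-cong q) (*-congˡ q)) (*-congˡ (*-congˡ p)) ⟩
      _              ≈⟨ rhs n ⟨
      y (suc n)      ∎)

module EgfRecurrence {c ℓ} {R : CommutativeRing c ℓ} {∂ : Derivation R} (𝓔 : EgfData ∂) where
  open CommutativeRing R
  open IntegerSolver R
  open Natural R
  open Derivation ∂
  open DerivationProperties ∂
  open SeriesRing R using (var-·-suc)
  open EgfData 𝓔
  open GeneratingFunction 𝓔 using (egf; egf-0; egf-suc)
  open Series rawRing using (var; _·_)
  open Recurrences ∂ x
  open SetoidReasoning setoid

  egf-recurrence : (fac : ℕ → Carrier) → fac 0 ≈ 1# → (∀ n → fac (suc n) ≈ ν (suc n) * fac n) →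
                   (∀ n → D (fac n) ≈ 0#) → Recurrence 1# (λ n → fac n * egf n)
  egf-recurrence fac fac-zero fac-suc D-fac = record
    { g-zero = trans (*-cong fac-zero egf-0) (*-identityˡ 1#)
    ; g-suc  = λ n → begin
        fac (suc n) * egf (suc n)
          ≈⟨ *-congʳ (fac-suc n) ⟩
        ν (suc n) * fac n * egf (suc n)
          ≈⟨ solve 3 (λ a b c → a :* b :* c := b :* (a :* c)) refl _ _ _ ⟩
        fac n * (ν (suc n) * egf (suc n))
          ≈⟨ *-congˡ (egf-suc n) ⟩
        fac n * (x * (ν n * egf n) + D (egf n) + egf n + x * (var · egf) n)
          ≈⟨ solve 6 (λ f x k e d z → f :* (x :* (k :* e) :+ d :+ e :+ x :* z)
               := f :* d :+ (k :* x :+ :1) :* (f :* e) :+ x :* (f :* z)) refl _ _ _ _ _ _ ⟩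
        fac n * D (egf n) + (ν n * x + 1#) * (fac n * egf n) + x * (fac n * (var · egf) n)
          ≈⟨ +-cong (+-congʳ (D-constant-* (fac n) (egf n) (D-fac n))) (shift n) ⟨
        D (fac n * egf n) + (ν n * x + 1#) * (fac n * egf n) + ν n * (x * (fac (pred n) * egf (pred n))) ∎
    }
    where
    -- Multiplying the series by z lowers the index, and n! = n (n - 1)! produces the coefficient
    -- `ν n`; in degree 0 both sides vanish.
    shift : ∀ n → ν n * (x * (fac (pred n) * egf (pred n))) ≈ x * (fac n * (var · egf) n)
    shift zero    = solve 4 (λ x f e z → :0 :* e := x :* (f :* (:0 :* z))) refl _ _ _ _
    shift (suc n) = begin
      ν (suc n) * (x * (fac n * egf n))  ≈⟨ solve 4 (λ k x f e → k :* (x :* (f :* e)) := x :* (k :* f :* e)) refl _ _ _ _ ⟩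
      x * (ν (suc n) * fac n * egf n)    ≈⟨ *-congˡ (*-cong (fac-suc n) (var-·-suc egf n)) ⟨
      x * (fac (suc n) * (var · egf) (suc n)) ∎

-- Sums over lists

module ListSum {c ℓ} (R : CommutativeRing c ℓ) where
  open CommutativeRing R
  open IntegerSolver R
  open SetoidReasoning setoid
  open SemiringSum semiring using (sum)

  -- The same fold as `Σx^`, so the sums in the theorem are instances by definition.
  ∑ : ∀ {a} {A : Set a} → List A → (A → Carrier) → Carrier
  ∑ xs f = foldr (λ a s → f a + s) 0# xs

  module _ {a} {A : Set a} where

    ∑-cong-∈ : ∀ (xs : List A) {f g} → (∀ {a} → a ∈ xs → f a ≈ g a) → ∑ xs f ≈ ∑ xs g
    ∑-cong-∈ []       p = refl
    ∑-cong-∈ (a ∷ xs) p = +-cong (p (here ≡.refl)) (∑-cong-∈ xs (p ∘ there))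

    ∑-cong : ∀ (xs : List A) {f g} → (∀ a → f a ≈ g a) → ∑ xs f ≈ ∑ xs g
    ∑-cong xs p = ∑-cong-∈ xs (λ {a} _ → p a)

    ∑-+ : ∀ (xs : List A) f g → ∑ xs (λ a → f a + g a) ≈ ∑ xs f + ∑ xs g
    ∑-+ []       f g = sym (+-identityˡ 0#)
    ∑-+ (a ∷ xs) f g = trans (+-congˡ (∑-+ xs f g))
      (solve 4 (λ a b c d → a :+ b :+ (c :+ d) := (a :+ c) :+ (b :+ d)) refl _ _ _ _)

    ∑-*ˡ : ∀ (xs : List A) k f → ∑ xs (λ a → k * f a) ≈ k * ∑ xs f
    ∑-*ˡ []       k f = sym (zeroʳ k)
    ∑-*ˡ (a ∷ xs) k f = trans (+-congˡ (∑-*ˡ xs k f)) (sym (distribˡ k _ _))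

    ∑-D : (∂ : Derivation R) (let open Derivation ∂) → ∀ (xs : List A) f → ∑ xs (D ∘ f) ≈ D (∑ xs f)
    ∑-D ∂ []       f = sym (DerivationProperties.D-0 ∂)
    ∑-D ∂ (a ∷ xs) f = trans (+-congˡ (∑-D ∂ xs f)) (sym (Derivation.D-+ ∂ _ _))

    ∑-↭ : ∀ {xs ys : List A} f → xs ↭ ys → ∑ xs f ≈ ∑ ys f
    ∑-↭ f Perm.refl         = refl
    ∑-↭ f (Perm.prep a p)   = +-congˡ (∑-↭ f p)
    ∑-↭ f (Perm.swap a b p) = trans (+-congˡ (+-congˡ (∑-↭ f p)))
      (solve 3 (λ a b c → a :+ (b :+ c) := b :+ (a :+ c)) refl _ _ _)
    ∑-↭ f (Perm.trans p q)  = trans (∑-↭ f p) (∑-↭ f q)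

    ∑-++ : ∀ (xs ys : List A) f → ∑ (xs ++ ys) f ≈ ∑ xs f + ∑ ys f
    ∑-++ []       ys f = sym (+-identityˡ _)
    ∑-++ (a ∷ xs) ys f = trans (+-congˡ (∑-++ xs ys f)) (sym (+-assoc _ _ _))

    ∑-filter : ∀ {p} {P : Pred A p} (P? : Decidable P) {f g} →
               (∀ {a} → P a → f a ≈ g a) → (∀ {a} → ¬ P a → g a ≈ 0#) →
               ∀ xs → ∑ (filter P? xs) f ≈ ∑ xs g
    ∑-filter P? yes≈ no≈ []       = refl
    ∑-filter P? yes≈ no≈ (a ∷ xs) with P? a
    ... | yes Pa = +-cong (yes≈ Pa) (∑-filter P? yes≈ no≈ xs)
    ... | no ¬Pa = begin
      _                     ≈⟨ ∑-filter P? yes≈ no≈ xs ⟩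
      ∑ xs _                ≈⟨ +-identityˡ _ ⟨
      0# + ∑ xs _           ≈⟨ +-congʳ (no≈ ¬Pa) ⟨
      _                     ∎

    ∑-tabulate : ∀ {n} (t : Fin n → A) f → ∑ (List.tabulate t) f ≈ sum (f ∘ t)
    ∑-tabulate {zero}  t f = refl
    ∑-tabulate {suc n} t f = +-congˡ (∑-tabulate (t ∘ Fin.suc) f)

  ∑-map : ∀ {a b} {A : Set a} {B : Set b} (h : A → B) xs f → ∑ (map h xs) f ≈ ∑ xs (f ∘ h)
  ∑-map h []       f = refl
  ∑-map h (a ∷ xs) f = +-congˡ (∑-map h xs f)

  ∑-cartesianProductWith : ∀ {a b c} {A : Set a} {B : Set b} {C : Set c} (h : A → B → C) xs ys f →
                           ∑ (cartesianProductWith h xs ys) f ≈ ∑ xs (λ a → ∑ ys (f ∘ h a))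
  ∑-cartesianProductWith h []       ys f = refl
  ∑-cartesianProductWith h (a ∷ xs) ys f = begin
    ∑ (map (h a) ys ++ cartesianProductWith h xs ys) f
      ≈⟨ ∑-++ (map (h a) ys) _ f ⟩
    ∑ (map (h a) ys) f + ∑ (cartesianProductWith h xs ys) f
      ≈⟨ +-cong (∑-map (h a) ys f) (∑-cartesianProductWith h xs ys f) ⟩
    ∑ ys (f ∘ h a) + ∑ xs (λ a → ∑ ys (f ∘ h a)) ∎

-- Joint distributions of two statistics under insertion

module TestFunction {c ℓ} {R : CommutativeRing c ℓ} (x : CommutativeRing.Carrier R) where
  open CommutativeRing R
  open RawSemiringDefs (RawRing.rawSemiring rawRing) using (_^_)

  -- The weight x^e 0^f. It expresses the restriction to f = 0 as a test function, to which
  -- insertion can be applied, instead of as a filter.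
  φ₀ : ℕ → ℕ → Carrier
  φ₀ e zero    = x ^ e
  φ₀ e (suc f) = 0#

module Statistics {c ℓ} {R : CommutativeRing c ℓ} (∂ : Derivation R) (x : CommutativeRing.Carrier R)
                  (k : CommutativeRing.Carrier R) where
  open CommutativeRing R
  open IntegerSolver R
  open Natural R
  open ListSum R
  open Derivation ∂
  open RawSemiringDefs (RawRing.rawSemiring rawRing) using (_^_)
  open SetoidReasoning setoid
  open Recurrences ∂ x using (Recurrence)
  open TestFunction {R = R} x

  -- Effect of one insertion step on a test function of two statistics, for
  -- objects of size n with statistics (e , f): f + 1 once, no change e + k times,
  -- (e + 1 , f - 1) f times, and e + 1 in the remaining n - e - f ways.
  insertion : ℕ → (ℕ → ℕ → Carrier) → ℕ → ℕ → Carrier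
  insertion n φ e f = φ e (suc f) + ν e * φ e f + ν f * φ (suc e) (pred f)
                    + (ν n + - ν e + - ν f) * φ (suc e) f + k * φ e f

  -- On weights s^e t^f this is ∂/∂t, while the first term of `insertion` is multiplication by t;
  -- hence the 1 in their commutator. `lower φ₀` is the weight x^e on objects with f = 1.
  lower : (ℕ → ℕ → Carrier) → ℕ → ℕ → Carrier
  lower φ e f = ν f * φ e (pred f)

  -- The commutation relation insertion ∘ lower - lower ∘ insertion = id, which
  -- forces E[lower φ] at size n to be n E[φ] at size n - 1.
  insertion-lower : ∀ n φ e f → insertion (suc n) (lower φ) e f ≈ φ e f + lower (insertion n φ) e f
  insertion-lower n φ e zero    =
    solve 6 (λ n e p q k s → (:1 :+ :0) :* p :+ e :* (:0 :* p) :+ :0 :* (:0 :* q)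
          :+ (:1 :+ n :+ (:- e) :+ (:- :0)) :* (:0 :* q) :+ k :* (:0 :* p)
        := p :+ :0 :* s) refl (ν n) (ν e) (φ e 0) (φ (suc e) 0) k (insertion n φ e 0)
  insertion-lower n φ e (suc f) =
    solve 8 (λ n e f p q r s k →
       (:1 :+ (:1 :+ f)) :* p :+ e :* ((:1 :+ f) :* q) :+ (:1 :+ f) :* (f :* r)
         :+ (:1 :+ n :+ (:- e) :+ (:- (:1 :+ f))) :* ((:1 :+ f) :* s) :+ k :* ((:1 :+ f) :* q)
       := p :+ (:1 :+ f) :* (p :+ e :* q :+ f :* r :+ (n :+ (:- e) :+ (:- f)) :* s :+ k :* q))
      refl (ν n) (ν e) (ν f) (φ e (suc f)) (φ e f) (φ (suc e) (pred f)) (φ (suc e) f) k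

  D-x^ : D x ≈ x * (1# + - x) → ∀ e → D (x ^ e) ≈ ν e * x ^ e * (1# + - x)
  D-x^ D-x zero    = trans D-1 (solve 1 (λ x → :0 := :0 :* :1 :* (:1 :+ (:- x))) refl x)
    where open DerivationProperties ∂
  D-x^ D-x (suc e) = trans (D-^ x e) (trans (*-congˡ (*-congˡ D-x))
    (solve 3 (λ k p x → k :* (p :* (x :* (:1 :+ (:- x)))) := k :* (x :* p) :* (:1 :+ (:- x))) refl (ν (suc e)) (x ^ e) x))
    where open DerivationProperties ∂

  -- For f = 0, D (x^e) = e x^e - e x^(e + 1) accounts for the e unchanged insertions and for the -e
  -- among the n - e that raise e. For f = 1 only the move to (e + 1 , 0) survives, which is
  -- `x * lower φ₀`; for larger f nothing reaches f = 0.
  insertion-φ₀ : D x ≈ x * (1# + - x) → ∀ n e f →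
    insertion n φ₀ e f ≈ D (φ₀ e f) + (ν n * x + k) * φ₀ e f + x * lower φ₀ e f
  insertion-φ₀ D-x n e zero = begin
    insertion n φ₀ e 0
      ≈⟨ solve 5 (λ x p e n k → :0 :+ e :* p :+ :0 :* (x :* p) :+ (n :+ (:- e) :+ (:- :0)) :* (x :* p) :+ k :* p
           := e :* p :* (:1 :+ (:- x)) :+ (n :* x :+ k) :* p :+ x :* (:0 :* p)) refl x (x ^ e) (ν e) (ν n) k ⟩
    ν e * x ^ e * (1# + - x) + (ν n * x + k) * x ^ e + x * (0# * x ^ e)
      ≈⟨ +-congʳ (+-congʳ (D-x^ D-x e)) ⟨
    D (x ^ e) + (ν n * x + k) * x ^ e + x * (0# * x ^ e) ∎
  insertion-φ₀ D-x n e (suc zero) = begin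
    insertion n φ₀ e 1
      ≈⟨ solve 5 (λ x p e n k → :0 :+ e :* :0 :+ (:1 :+ :0) :* (x :* p) :+ (n :+ (:- e) :+ (:- (:1 :+ :0))) :* :0 :+ k :* :0
           := :0 :+ (n :* x :+ k) :* :0 :+ x :* ((:1 :+ :0) :* p)) refl x (x ^ e) (ν e) (ν n) k ⟩
    0# + (ν n * x + k) * 0# + x * lower φ₀ e 1
      ≈⟨ +-congʳ (+-congʳ (DerivationProperties.D-0 ∂)) ⟨
    D 0# + (ν n * x + k) * 0# + x * lower φ₀ e 1 ∎
  insertion-φ₀ D-x n e (suc (suc f)) = begin
    insertion n φ₀ e (suc (suc f))
      ≈⟨ solve 5 (λ x e f n k → :0 :+ e :* :0 :+ f :* :0 :+ (n :+ (:- e) :+ (:- f)) :* :0 :+ k :* :0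
           := :0 :+ (n :* x :+ k) :* :0 :+ x :* (f :* :0)) refl x (ν e) (ν (suc (suc f))) (ν n) k ⟩
    0# + (ν n * x + k) * 0# + x * lower φ₀ e (suc (suc f))
      ≈⟨ +-congʳ (+-congʳ (DerivationProperties.D-0 ∂)) ⟨
    D 0# + (ν n * x + k) * 0# + x * lower φ₀ e (suc (suc f)) ∎

  module _ {a} (A : ℕ → Set a) (xs : ∀ n → List (A n)) (stat₁ stat₂ : ∀ {n} → A n → ℕ) where

    ⟪_,_⟫ : ℕ → (ℕ → ℕ → Carrier) → Carrier
    ⟪ n , φ ⟫ = ∑ (xs n) (λ a → φ (stat₁ a) (stat₂ a))

    module _ (base : ∀ φ → ⟪ 0 , φ ⟫ ≈ φ 0 0) (step : ∀ n φ → ⟪ suc n , φ ⟫ ≈ ⟪ n , insertion n φ ⟫) where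

      -- Combinatorially: deleting a marked fixed point, or merging a marked succession into one
      -- letter, leaves an arbitrary object one size smaller, with n ways back. No such map is
      -- built; induction on n with `insertion-lower` suffices.
      ⟪lower⟫ : ∀ n φ → ⟪ n , lower φ ⟫ ≈ ν n * ⟪ pred n , φ ⟫
      ⟪lower⟫-suc : ∀ n φ → ⟪ suc n , lower φ ⟫ ≈ ν (suc n) * ⟪ n , φ ⟫

      ⟪lower⟫ zero    φ = trans (base (lower φ)) (trans (zeroˡ _) (sym (zeroˡ _)))
      ⟪lower⟫ (suc n) φ = ⟪lower⟫-suc n φ

      ⟪lower⟫-suc zero    φ = begin
        ⟪ 1 , lower φ ⟫              ≈⟨ step 0 (lower φ) ⟩
        ⟪ 0 , insertion 0 (lower φ) ⟫ ≈⟨ base (insertion 0 (lower φ)) ⟩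
        insertion 0 (lower φ) 0 0
          ≈⟨ solve 3 (λ p q k → (:1 :+ :0) :* p :+ :0 :* (:0 :* p) :+ :0 :* (:0 :* q)
                 :+ (:0 :+ (:- :0) :+ (:- :0)) :* (:0 :* q) :+ k :* (:0 :* p)
               := (:1 :+ :0) :* p) refl (φ 0 0) (φ 1 0) k ⟩
        ν 1 * φ 0 0                  ≈⟨ *-congˡ (base φ) ⟨
        ν 1 * ⟪ 0 , φ ⟫              ∎
      ⟪lower⟫-suc (suc n) φ = begin
        ⟪ suc (suc n) , lower φ ⟫                 ≈⟨ step (suc n) (lower φ) ⟩
        ⟪ suc n , insertion (suc n) (lower φ) ⟫   ≈⟨ ∑-cong (xs (suc n)) (λ a → insertion-lower n φ (stat₁ a) (stat₂ a)) ⟩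
        ∑ (xs (suc n)) (λ a → φ (stat₁ a) (stat₂ a) + lower (insertion n φ) (stat₁ a) (stat₂ a))
          ≈⟨ ∑-+ (xs (suc n)) _ _ ⟩
        ⟪ suc n , φ ⟫ + ⟪ suc n , lower (insertion n φ) ⟫
          ≈⟨ +-congˡ (⟪lower⟫-suc n (insertion n φ)) ⟩
        ⟪ suc n , φ ⟫ + ν (suc n) * ⟪ n , insertion n φ ⟫
          -- The insertion step read backwards merges the induction hypothesis with the first
          -- summand.
          ≈⟨ +-congˡ (*-congˡ (step n φ)) ⟨
        ⟪ suc n , φ ⟫ + ν (suc n) * ⟪ suc n , φ ⟫
          ≈⟨ solve 2 (λ a k → a :+ k :* a := (:1 :+ k) :* a) refl _ _ ⟩
        ν (suc (suc n)) * ⟪ suc n , φ ⟫ ∎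

      recurrence : D x ≈ x * (1# + - x) → Recurrence k (λ n → ⟪ n , φ₀ ⟫)
      recurrence D-x = record
        { g-zero = base φ₀
        ; g-suc  = λ n → begin
            ⟪ suc n , φ₀ ⟫
              ≈⟨ step n φ₀ ⟩
            ⟪ n , insertion n φ₀ ⟫
              ≈⟨ ∑-cong (xs n) (λ a → insertion-φ₀ D-x n (stat₁ a) (stat₂ a)) ⟩
            ∑ (xs n) (λ a → D (w a) + (ν n * x + k) * w a + x * v a)
              ≈⟨ trans (∑-+ (xs n) _ _) (+-congʳ (∑-+ (xs n) _ _)) ⟩
            ∑ (xs n) (λ a → D (w a)) + ∑ (xs n) (λ a → (ν n * x + k) * w a) + ∑ (xs n) (λ a → x * v a)
              ≈⟨ +-cong (+-cong (∑-D ∂ (xs n) w) (∑-*ˡ (xs n) _ w)) (∑-*ˡ (xs n) x v) ⟩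
            D ⟪ n , φ₀ ⟫ + (ν n * x + k) * ⟪ n , φ₀ ⟫ + x * ⟪ n , lower φ₀ ⟫
              ≈⟨ +-congˡ (*-congˡ (⟪lower⟫ n φ₀)) ⟩
            D ⟪ n , φ₀ ⟫ + (ν n * x + k) * ⟪ n , φ₀ ⟫ + x * (ν n * ⟪ pred n , φ₀ ⟫)
              ≈⟨ +-congˡ (solve 3 (λ x k p → x :* (k :* p) := k :* (x :* p)) refl _ _ _) ⟩
            D ⟪ n , φ₀ ⟫ + (ν n * x + k) * ⟪ n , φ₀ ⟫ + ν n * (x * ⟪ pred n , φ₀ ⟫) ∎
        }
        where
        w v : ∀ {n} → A n → Carrier
        w a = φ₀ (stat₁ a) (stat₂ a)
        v a = lower φ₀ (stat₁ a) (stat₂ a)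

-- Permutations built by inserting a smallest letter

module Permutations where
  open import Data.Nat.Base using (_+_; _∸_)
  open ≡ using (_≢_; refl; sym; trans; cong; cong₂; subst; module ≡-Reasoning)
  open SemiringSum ℕ.+-*-semiring using (sum; sum-remove; sum-cong-≗; sum-replicate-zero; ∑-distrib-+)

  ∈-vectors : ∀ {n m} (v : Vec (Fin n) m) → v ∈ vectors n m
  ∈-vectors []      = here refl
  ∈-vectors (a ∷ v) = ∈-cartesianProductWith⁺ _∷_ (∈-allFin a) (∈-vectors v)

  vectors-unique : ∀ n m → Unique (vectors n m)
  vectors-unique n zero    = All.[] AllPairs.∷ AllPairs.[]
  vectors-unique n (suc m) = Unique.cartesianProductWith⁺ _∷_ ∷-injective (Unique.allFin⁺ n) (vectors-unique n m)

  𝔖-unique : ∀ n → Unique (𝔖 n)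
  𝔖-unique n = Unique.filter⁺ isPermutation? (vectors-unique n n)

  ∈-𝔖⁺ : ∀ {n} {w : Word n} → IsPermutation w → w ∈ 𝔖 n
  ∈-𝔖⁺ {w = w} = ∈-filter⁺ isPermutation? (∈-vectors w)

  ∈-𝔖⁻ : ∀ {n} {w : Word n} → w ∈ 𝔖 n → IsPermutation w
  ∈-𝔖⁻ {n} = proj₂ ∘ ∈-filter⁻ isPermutation? {xs = vectors n n}

  lookup-ext : ∀ {a} {A : Set a} {n} {v w : Vec A n} → (∀ i → lookup v i ≡ lookup w i) → v ≡ w
  lookup-ext {v = v} {w} p = trans (sym (tabulate∘lookup v)) (trans (tabulate-cong p) (tabulate∘lookup w))

  module _ {n} (w : Word n) where

    extend : Word (suc n)
    extend = zero ∷ Vec.map suc w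

    lookup-extend-suc : ∀ i → lookup extend (suc i) ≡ suc (lookup w i)
    lookup-extend-suc i = lookup-map i suc w

    extend-zero⁻¹ : ∀ i → lookup extend i ≡ zero → i ≡ zero
    extend-zero⁻¹ zero    _  = refl
    extend-zero⁻¹ (suc i) eq = contradiction (trans (sym eq) (lookup-extend-suc i)) λ ()

    extend-isPermutation : IsPermutation w → IsPermutation extend
    extend-isPermutation (inj , surj) = inj′ , surj′
      where
      inj′ : ∀ {i j} → lookup extend i ≡ lookup extend j → i ≡ j
      inj′ {zero}  {j}     eq = sym (extend-zero⁻¹ j (sym eq))
      inj′ {suc i} {zero}  eq = extend-zero⁻¹ (suc i) eq
      inj′ {suc i} {suc j} eq = cong suc (inj (Fin.suc-injective
        (trans (sym (lookup-extend-suc i)) (trans eq (lookup-extend-suc j)))))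
      surj′ : ∀ j → ∃ λ i → ∀ {k} → k ≡ i → lookup extend k ≡ j
      surj′ zero    = zero , λ { refl → refl }
      surj′ (suc j) with surj j
      ... | i , p = suc i , λ { refl → trans (lookup-extend-suc i) (cong suc (p refl)) }

  -- τ p moves the new letter zero to position p.
  module Insertion {n} (τ : Fin (suc n) → Permutation′ (suc n)) (τ-zero : ∀ p → τ p ⟨$⟩ʳ p ≡ zero) where

    insert : Word n → Fin (suc n) → Word (suc n)
    insert w p = tabulate (λ i → lookup (extend w) (τ p ⟨$⟩ʳ i))

    lookup-insert : ∀ w p i → lookup (insert w p) i ≡ lookup (extend w) (τ p ⟨$⟩ʳ i)
    lookup-insert w p = lookup∘tabulate (λ i → lookup (extend w) (τ p ⟨$⟩ʳ i))

    τ-injective : ∀ p {i j} → τ p ⟨$⟩ʳ i ≡ τ p ⟨$⟩ʳ j → i ≡ j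
    τ-injective p {i} {j} eq = trans (sym (inverseˡ (τ p))) (trans (cong (τ p ⟨$⟩ˡ_) eq) (inverseˡ (τ p)))

    insert-isPermutation : ∀ {w} p → IsPermutation w → IsPermutation (insert w p)
    insert-isPermutation {w} p w-perm = inj′ , surj′
      where
      inj  = proj₁ (extend-isPermutation w w-perm)
      surj = proj₂ (extend-isPermutation w w-perm)
      inj′ : ∀ {i j} → lookup (insert w p) i ≡ lookup (insert w p) j → i ≡ j
      inj′ {i} {j} eq = τ-injective p (inj
        (trans (sym (lookup-insert w p i)) (trans eq (lookup-insert w p j))))
      surj′ : ∀ j → ∃ λ i → ∀ {k} → k ≡ i → lookup (insert w p) k ≡ j
      surj′ j with surj j
      ... | i , q = τ p ⟨$⟩ˡ i , λ { refl → trans (lookup-insert w p _) (q (inverseʳ (τ p))) }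

    -- The letter `zero` occurs in `extend w` only at position `zero`, so its place in the inserted
    -- word recovers `p`; undoing `τ p` then recovers `w`.
    insert-injective : ∀ {w w′ p p′} → insert w p ≡ insert w′ p′ → w ≡ w′ × p ≡ p′
    insert-injective {w} {w′} {p} {p′} eq = lookup-ext w≗w′ , p≡p′
      where
      agree : ∀ i → lookup (extend w) (τ p ⟨$⟩ʳ i) ≡ lookup (extend w′) (τ p′ ⟨$⟩ʳ i)
      agree i = trans (sym (lookup-insert w p i)) (trans (cong (λ v → lookup v i) eq) (lookup-insert w′ p′ i))
      p≡p′ : p ≡ p′
      p≡p′ = τ-injective p′ (trans
        (extend-zero⁻¹ w′ _ (trans (sym (agree p)) (cong (lookup (extend w)) (τ-zero p))))
        (sym (τ-zero p′)))
      extensions : ∀ k → lookup (extend w) k ≡ lookup (extend w′) k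
      extensions k = trans (cong (lookup (extend w)) (sym (inverseʳ (τ p))))
        (trans (agree (τ p ⟨$⟩ˡ k))
        (trans (cong (λ q → lookup (extend w′) (τ q ⟨$⟩ʳ (τ p ⟨$⟩ˡ k))) (sym p≡p′))
               (cong (lookup (extend w′)) (inverseʳ (τ p)))))
      w≗w′ : ∀ i → lookup w i ≡ lookup w′ i
      w≗w′ i = Fin.suc-injective (trans (sym (lookup-extend-suc w i))
        (trans (extensions (suc i)) (lookup-extend-suc w′ i)))

    -- The inverse of `insert`: `p` is where `v` takes the value `zero`, undoing `τ p` brings that
    -- letter to the front, and the rest, lowered by one, is `w`.
    module Deletion (v : Word (suc n)) (v-perm : IsPermutation v) where
      inj = proj₁ v-perm

      p : Fin (suc n)
      p = proj₁ (proj₂ v-perm zero)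

      v-p : lookup v p ≡ zero
      v-p = proj₂ (proj₂ v-perm zero) refl

      u : Fin (suc n) → Fin (suc n)
      u i = lookup v (τ p ⟨$⟩ˡ i)

      u-zero : u zero ≡ zero
      u-zero = trans (cong (lookup v) (trans (cong (τ p ⟨$⟩ˡ_) (sym (τ-zero p))) (inverseˡ (τ p)))) v-p

      u-suc : ∀ i → zero ≢ u (suc i)
      u-suc i eq = contradiction
        (trans (sym (inverseʳ (τ p))) (trans (cong (τ p ⟨$⟩ʳ_) (inj (trans u-zero eq))) (inverseʳ (τ p))))
        λ ()

      w : Word n
      w = tabulate (λ i → Fin.punchOut (u-suc i))

      suc-w : ∀ i → suc (lookup w i) ≡ u (suc i)
      suc-w i = trans (cong suc (lookup∘tabulate _ i)) (Fin.punchIn-punchOut (u-suc i))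

      extend-w : ∀ i → lookup (extend w) i ≡ u i
      extend-w zero    = sym u-zero
      extend-w (suc i) = trans (lookup-extend-suc w i) (suc-w i)

      v≡insert : v ≡ insert w p
      v≡insert = lookup-ext λ i → sym (trans (lookup-insert w p i)
        (trans (extend-w (τ p ⟨$⟩ʳ i)) (cong (lookup v) (inverseˡ (τ p)))))

      w-perm : IsPermutation w
      w-perm = inj′ , surj′
        where
        inj′ : ∀ {i j} → lookup w i ≡ lookup w j → i ≡ j
        inj′ {i} {j} eq = Fin.suc-injective (trans (sym (inverseʳ (τ p)))
          (trans (cong (τ p ⟨$⟩ʳ_) (inj (trans (sym (suc-w i)) (trans (cong suc eq) (suc-w j)))))
                 (inverseʳ (τ p))))
        surj′ : ∀ j → ∃ λ i → ∀ {k} → k ≡ i → lookup w k ≡ j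
        surj′ j with proj₂ v-perm (suc j)
        ... | k , q with τ p ⟨$⟩ʳ k in τk
        ...   | zero  = contradiction (trans (sym u-zero) (trans (cong (λ i → lookup v (τ p ⟨$⟩ˡ i)) (sym τk)) (q (inverseˡ (τ p))))) λ ()
        ...   | suc i = i , λ { refl → Fin.suc-injective
                  (trans (suc-w i) (trans (cong (λ i → lookup v (τ p ⟨$⟩ˡ i)) (sym τk)) (q (inverseˡ (τ p))))) }

    -- The two lists are ordered differently, but neither has repetitions, so equal membership
    -- already makes them permutations of each other.
    𝔖-suc : 𝔖 (suc n) ↭ cartesianProductWith insert (𝔖 n) (allFin (suc n))
    𝔖-suc = ∼bag⇒↭ (unique∧set⇒bag (𝔖-unique (suc n))
      (Unique.cartesianProductWith⁺ insert insert-injective (𝔖-unique n) (Unique.allFin⁺ (suc n)))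
      (mk⇔ to from))
      where
      to : ∀ {v} → v ∈ 𝔖 (suc n) → v ∈ cartesianProductWith insert (𝔖 n) (allFin (suc n))
      to {v} v∈ = subst (_∈ cartesianProductWith insert (𝔖 n) (allFin (suc n))) (sym v≡insert)
        (∈-cartesianProductWith⁺ insert (∈-𝔖⁺ w-perm) (∈-allFin p))
        where open Deletion v (∈-𝔖⁻ v∈)
      from : ∀ {v} → v ∈ cartesianProductWith insert (𝔖 n) (allFin (suc n)) → v ∈ 𝔖 (suc n)
      from v∈ with ∈-cartesianProductWith⁻ insert (𝔖 n) (allFin (suc n)) v∈
      ... | w , p , w∈ , _ , refl = ∈-𝔖⁺ (insert-isPermutation p (∈-𝔖⁻ w∈))

  indicator : ∀ {p} {P : Set p} → Dec P → ℕ
  indicator P? = if does P? then 1 else 0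

  count-tabulate : ∀ {a p} {A : Set a} {P : Pred A p} (P? : Decidable P) {n} (t : Fin n → A) →
                   Vec.count P? (tabulate t) ≡ sum (λ i → indicator (P? (t i)))
  count-tabulate P? {zero}  t = refl
  count-tabulate P? {suc n} t with does (P? (t zero))
  ... | true  = cong suc (count-tabulate P? (t ∘ suc))
  ... | false = count-tabulate P? (t ∘ suc)

  count-allFin : ∀ {p n} {P : Pred (Fin n) p} (P? : Decidable P) → Vec.count P? (Vec.allFin n) ≡ sum (indicator ∘ P?)
  count-allFin P? = count-tabulate P? id

  sum≡0⇒≡0 : ∀ {n} (t : Fin n → ℕ) → sum t ≡ 0 → ∀ i → t i ≡ 0
  sum≡0⇒≡0 t eq zero    = ℕ.m+n≡0⇒m≡0 (t zero) eq
  sum≡0⇒≡0 t eq (suc i) = sum≡0⇒≡0 (t ∘ suc) (ℕ.m+n≡0⇒n≡0 (t zero) eq) i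

  ≡0⇒sum≡0 : ∀ {n} (t : Fin n → ℕ) → (∀ i → t i ≡ 0) → sum t ≡ 0
  ≡0⇒sum≡0 {n} t eq = trans (sum-cong-≗ eq) (sum-replicate-zero n)

  sum-erase : ∀ {n} (s t : Fin n → ℕ) j → s j ≡ 0 → (∀ i → i ≢ j → s i ≡ t i) → t j + sum s ≡ sum t
  sum-erase {suc n} s t j s≡0 s≡t = begin
    t j + sum s                              ≡⟨ cong (t j +_) (sum-remove {i = j} s) ⟩
    t j + (s j + sum (λ k → s (punchIn j k)))
      ≡⟨ cong (λ m → t j + (m + sum (λ k → s (punchIn j k)))) s≡0 ⟩
    t j + sum (λ k → s (punchIn j k))
      ≡⟨ cong (t j +_) (sum-cong-≗ (λ k → s≡t (punchIn j k) (Fin.punchInᵢ≢i j k))) ⟩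
    t j + sum (λ k → t (punchIn j k))        ≡⟨ sum-remove {i = j} t ⟨
    sum t                                    ∎
    where open ≡-Reasoning

  -- The possible values of three indicators of mutually exclusive events.
  data Class : ℕ → ℕ → ℕ → Set where
    first  : Class 1 0 0
    second : Class 0 1 0
    third  : Class 0 0 1
    none   : Class 0 0 0

  -- Cycle insertion: excedances and fixed points

  exceed : ∀ {n} → Word n → Fin n → ℕ
  exceed w i = indicator (i Fin.<? lookup w i)

  fixed : ∀ {n} → Word n → Fin n → ℕ
  fixed w i = indicator (lookup w i Fin.≟ i)

  fix : ∀ {n} → Word n → ℕ
  fix w = sum (fixed w)

  exc≡sum : ∀ {n} (w : Word n) → exc w ≡ sum (exceed w)
  exc≡sum w = count-allFin (λ i → i Fin.<? lookup w i)

  indicator-no : ∀ {p} {P : Set p} (P? : Dec P) → ¬ P → indicator P? ≡ 0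
  indicator-no (yes p) ¬p = contradiction p ¬p
  indicator-no (no _)  _  = refl

  indicator≡0⇒¬ : ∀ {p} {P : Set p} (P? : Dec P) → indicator P? ≡ 0 → ¬ P
  indicator≡0⇒¬ (no ¬p) _ = ¬p

  derangement⇒fix≡0 : ∀ {n} (w : Word n) → Derangement w → fix w ≡ 0
  derangement⇒fix≡0 w der = ≡0⇒sum≡0 (fixed w) (λ i → indicator-no (lookup w i Fin.≟ i) (der i))

  fix≡0⇒derangement : ∀ {n} (w : Word n) → fix w ≡ 0 → Derangement w
  fix≡0⇒derangement w eq i = indicator≡0⇒¬ (lookup w i Fin.≟ i) (sum≡0⇒≡0 (fixed w) eq i)

  exclusive-class : ∀ {p q} {P : Set p} {Q : Set q} (P? : Dec P) (Q? : Dec Q) → (P → ¬ Q) →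
                    Class (indicator P?) (indicator Q?) 0
  exclusive-class (yes p) (yes q) ¬pq = contradiction q (¬pq p)
  exclusive-class (yes _) (no _)  _   = first
  exclusive-class (no _)  (yes _) _   = second
  exclusive-class (no _)  (no _)  _   = none

  exceed-fixed-class : ∀ {n} (w : Word n) i → Class (exceed w i) (fixed w i) 0
  exceed-fixed-class w i = exclusive-class (i Fin.<? lookup w i) (lookup w i Fin.≟ i)
    (λ i<wi wi≡i → ℕ.<⇒≢ i<wi (cong toℕ (sym wi≡i)))

  -- Precomposing `extend w` with the transposition of 0 and `suc j` inserts 0 into the cycle
  -- through j, as suc j ↦ 0 ↦ suc (w j). For p = 0 nothing is swapped and 0 is a new fixed point.
  τ-cycle : ∀ {n} → Fin (suc n) → Permutation′ (suc n)
  τ-cycle p = FinPerm.transpose zero p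

  τ-cycle-zero : ∀ {n} (p : Fin (suc n)) → τ-cycle p ⟨$⟩ʳ p ≡ zero
  τ-cycle-zero zero    = refl
  τ-cycle-zero (suc j) with j Fin.≟ j
  ... | yes _  = refl
  ... | no j≢j = contradiction refl j≢j

  module Cycle {n : ℕ} where
    open Insertion {n} τ-cycle τ-cycle-zero public

    insert-zero : ∀ w → insert w zero ≡ extend w
    insert-zero w = lookup-ext λ i → trans (lookup-insert w zero i) (cong (lookup (extend w)) (transpose-refl i))
      where
      transpose-refl : ∀ i → τ-cycle zero ⟨$⟩ʳ i ≡ i
      transpose-refl zero    = refl
      transpose-refl (suc i) = refl

    module _ (w : Word n) where
      lookup-insert-suc-≡ : ∀ j → lookup (insert w (suc j)) (suc j) ≡ zero
      lookup-insert-suc-≡ j = trans (lookup-insert w (suc j) (suc j)) (cong (lookup (extend w)) (τ-cycle-zero (suc j)))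

      lookup-insert-suc-≢ : ∀ {i j} → i ≢ j → lookup (insert w (suc j)) (suc i) ≡ suc (lookup w i)
      lookup-insert-suc-≢ {i} {j} i≢j = trans (lookup-insert w (suc j) (suc i))
        (trans (cong (lookup (extend w)) τ-fixes) (lookup-extend-suc w i))
        where
        τ-fixes : τ-cycle (suc j) ⟨$⟩ʳ suc i ≡ suc i
        τ-fixes with i Fin.≟ j
        ... | yes i≡j = contradiction i≡j i≢j
        ... | no _    = refl

      lookup-insert-suc-zero : ∀ j → lookup (insert w (suc j)) zero ≡ suc (lookup w j)
      lookup-insert-suc-zero j = trans (lookup-insert w (suc j) zero) (lookup-extend-suc w j)

      exceedAt : ∀ {m} → Fin m → Fin m → ℕ
      exceedAt i v = indicator (i Fin.<? v)

      exc-insert-zero : exc (insert w zero) ≡ exc w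
      exc-insert-zero = trans (cong exc (insert-zero w)) (trans (exc≡sum (extend w))
        (trans (sum-cong-≗ (λ i → cong (exceedAt (suc i)) (lookup-extend-suc w i))) (sym (exc≡sum w))))

      fix-insert-zero : fix (insert w zero) ≡ suc (fix w)
      fix-insert-zero = trans (cong fix (insert-zero w))
        (cong suc (sum-cong-≗ (λ i → cong (λ v → indicator (v Fin.≟ suc i)) (lookup-extend-suc w i))))

      -- Position 0 becomes an excedance, position `suc j` now has value 0 and is none, and every
      -- other position keeps its status. The additive form avoids truncated subtraction.
      exc-insert-suc : ∀ j → exc (insert w (suc j)) + exceed w j ≡ exc w + 1
      exc-insert-suc j = begin
        exc v + exceed w j
          ≡⟨ cong (_+ exceed w j) (exc≡sum v) ⟩
        (exceed v zero + sum (exceed v ∘ suc)) + exceed w j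
          ≡⟨ cong (λ k → (k + sum (exceed v ∘ suc)) + exceed w j) (cong (exceedAt zero) (lookup-insert-suc-zero j)) ⟩
        suc (sum (exceed v ∘ suc) + exceed w j)
          ≡⟨ cong suc (ℕ.+-comm _ (exceed w j)) ⟩
        suc (exceed w j + sum (exceed v ∘ suc))
          ≡⟨ cong suc (sum-erase (exceed v ∘ suc) (exceed w) j
               (cong (exceedAt (suc j)) (lookup-insert-suc-≡ j))
               (λ i i≢j → cong (exceedAt (suc i)) (lookup-insert-suc-≢ i≢j))) ⟩
        suc (sum (exceed w))
          ≡⟨ cong suc (exc≡sum w) ⟨
        suc (exc w)
          ≡⟨ ℕ.+-comm 1 (exc w) ⟩
        exc w + 1 ∎
        where
        open ≡-Reasoning
        v = insert w (suc j)

      fix-insert-suc : ∀ j → fix (insert w (suc j)) + fixed w j ≡ fix w + 0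
      fix-insert-suc j = begin
        (fixed v zero + sum (fixed v ∘ suc)) + fixed w j
          ≡⟨ cong (λ k → (k + sum (fixed v ∘ suc)) + fixed w j) (cong (λ a → indicator (a Fin.≟ zero)) (lookup-insert-suc-zero j)) ⟩
        sum (fixed v ∘ suc) + fixed w j
          ≡⟨ ℕ.+-comm _ (fixed w j) ⟩
        fixed w j + sum (fixed v ∘ suc)
          ≡⟨ sum-erase (fixed v ∘ suc) (fixed w) j
               (cong (λ a → indicator (a Fin.≟ suc j)) (lookup-insert-suc-≡ j))
               (λ i i≢j → cong (λ a → indicator (a Fin.≟ suc i)) (lookup-insert-suc-≢ i≢j)) ⟩
        fix w
          ≡⟨ ℕ.+-identityʳ (fix w) ⟨
        fix w + 0 ∎
        where
        open ≡-Reasoning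
        v = insert w (suc j)

  -- Word insertion: ascents and successions

  leap : ℕ → ℕ → ℕ
  leap zero    zero          = 0
  leap zero    (suc zero)    = 0
  leap zero    (suc (suc b)) = 1
  leap (suc a) zero          = 0
  leap (suc a) (suc b)       = leap a b

  -- `leap a b` and `next a b` are the indicators of b ≥ a + 2 and b = a + 1. The recursive
  -- definitions make invariance under raising both letters hold by `refl`.
  next : ℕ → ℕ → ℕ
  next zero    zero          = 0
  next zero    (suc zero)    = 1
  next zero    (suc (suc b)) = 0
  next (suc a) zero          = 0
  next (suc a) (suc b)       = next a b

  isZero : ℕ → ℕ
  isZero zero    = 1
  isZero (suc _) = 0

  leap-next-class : ∀ a b → Class (leap a b) (next a b) (isZero b)
  leap-next-class zero    zero          = third
  leap-next-class zero    (suc zero)    = second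
  leap-next-class zero    (suc (suc b)) = first
  leap-next-class (suc a) zero          = third
  leap-next-class (suc a) (suc b)       = weaken a b
    where
    -- Once a `suc` is peeled off, the original second letter is nonzero, so b = 0 now means a plain
    -- non-ascent: `none` instead of `third`.
    weaken : ∀ a b → Class (leap a b) (next a b) 0
    weaken zero    zero          = none
    weaken zero    (suc zero)    = second
    weaken zero    (suc (suc b)) = first
    weaken (suc a) zero          = none
    weaken (suc a) (suc b)       = weaken a b

  leap+next : ∀ a b → leap a b + next a b ≡ indicator (a ℕ.<? b)
  leap+next zero    zero          = refl
  leap+next zero    (suc zero)    = refl
  leap+next zero    (suc (suc b)) = refl
  leap+next (suc a) zero          = refl
  leap+next (suc a) (suc b)       = leap+next a b

  next≡0⇒≢ : ∀ a b → next a b ≡ 0 → b ≢ suc a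
  next≡0⇒≢ zero    (suc zero)    () refl
  next≡0⇒≢ (suc a) (suc .(suc a)) eq refl = next≡0⇒≢ a (suc a) eq refl

  ≢⇒next≡0 : ∀ a b → b ≢ suc a → next a b ≡ 0
  ≢⇒next≡0 zero    zero          _   = refl
  ≢⇒next≡0 zero    (suc zero)    b≢1 = contradiction refl b≢1
  ≢⇒next≡0 zero    (suc (suc b)) _   = refl
  ≢⇒next≡0 (suc a) zero          _   = refl
  ≢⇒next≡0 (suc a) (suc b)       b≢a = ≢⇒next≡0 a b (b≢a ∘ cong suc)

  module Adjacent (q : ℕ → ℕ → ℕ) where

    pair : ∀ {m n} → Vec (Fin m) (suc n) → Fin n → ℕ
    pair w i = q (toℕ (lookup w (inject₁ i))) (toℕ (lookup w (suc i)))

    adjacent : ∀ {m n} → Vec (Fin m) (suc n) → ℕ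
    adjacent w = sum (pair w)

    -- The contribution of the pair that is broken by an insertion in front of position i; in front
    -- of the first letter no pair is broken.
    before : ∀ {m n} → Vec (Fin m) (suc n) → Fin (suc n) → ℕ
    before w zero    = 0
    before w (suc i) = pair w i

    module _ (q-suc : ∀ a b → q (suc a) (suc b) ≡ q a b) (q-zero : ∀ a → q (suc a) 0 ≡ 0) where

      adjacent-map-suc : ∀ {m n} (w : Vec (Fin m) (suc n)) → adjacent (Vec.map suc w) ≡ adjacent w
      adjacent-map-suc (a ∷ [])    = refl
      adjacent-map-suc (a ∷ b ∷ w) = cong₂ _+_ (q-suc (toℕ a) (toℕ b)) (adjacent-map-suc (b ∷ w))

      -- The broken pair (a , b) is replaced by (a + 1 , 0) and (0 , b + 1). The first contributes
      -- nothing by `q-zero`, and all other pairs are merely raised.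
      adjacent-insert : ∀ {m n} (w : Vec (Fin m) (suc n)) i →
        adjacent (insertAt (Vec.map suc w) (inject₁ i) zero) + before w i ≡ adjacent w + q 0 (suc (toℕ (lookup w i)))
      adjacent-insert w@(a ∷ _) zero = begin
        (q₀ + adjacent (Vec.map suc w)) + 0  ≡⟨ ℕ.+-identityʳ _ ⟩
        q₀ + adjacent (Vec.map suc w)        ≡⟨ ℕ.+-comm q₀ _ ⟩
        adjacent (Vec.map suc w) + q₀        ≡⟨ cong (_+ q₀) (adjacent-map-suc w) ⟩
        adjacent w + q₀                      ∎
        where
        open ≡-Reasoning
        q₀ = q 0 (suc (toℕ a))
      adjacent-insert (a ∷ b ∷ w) (suc zero) = begin
        (q (suc (toℕ a)) 0 + (q₀ + adjacent (Vec.map suc (b ∷ w)))) + q (toℕ a) (toℕ b)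
          ≡⟨ cong₂ (λ k l → (k + (q₀ + l)) + q (toℕ a) (toℕ b)) (q-zero (toℕ a)) (adjacent-map-suc (b ∷ w)) ⟩
        (q₀ + adjacent (b ∷ w)) + q (toℕ a) (toℕ b)
          ≡⟨ ℕ.+-assoc q₀ _ _ ⟩
        q₀ + (adjacent (b ∷ w) + q (toℕ a) (toℕ b))
          ≡⟨ ℕ.+-comm q₀ _ ⟩
        (adjacent (b ∷ w) + q (toℕ a) (toℕ b)) + q₀
          ≡⟨ cong (_+ q₀) (ℕ.+-comm (adjacent (b ∷ w)) _) ⟩
        (q (toℕ a) (toℕ b) + adjacent (b ∷ w)) + q₀ ∎
        where
        open ≡-Reasoning
        q₀ = q 0 (suc (toℕ b))
      adjacent-insert (a ∷ b ∷ w) (suc (suc i)) = begin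
        (q (suc (toℕ a)) (suc (toℕ b)) + adjacent v) + pair (b ∷ w) i
          ≡⟨ cong (λ k → (k + adjacent v) + pair (b ∷ w) i) (q-suc (toℕ a) (toℕ b)) ⟩
        (q (toℕ a) (toℕ b) + adjacent v) + pair (b ∷ w) i
          ≡⟨ ℕ.+-assoc (q (toℕ a) (toℕ b)) _ _ ⟩
        q (toℕ a) (toℕ b) + (adjacent v + pair (b ∷ w) i)
          ≡⟨ cong (q (toℕ a) (toℕ b) +_) (adjacent-insert (b ∷ w) (suc i)) ⟩
        q (toℕ a) (toℕ b) + (adjacent (b ∷ w) + q₀)
          ≡⟨ ℕ.+-assoc (q (toℕ a) (toℕ b)) _ _ ⟨
        (q (toℕ a) (toℕ b) + adjacent (b ∷ w)) + q₀ ∎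
        where
        open ≡-Reasoning
        v  = insertAt (Vec.map suc (b ∷ w)) (inject₁ (suc i)) zero
        q₀ = q 0 (suc (toℕ (lookup w i)))

      adjacent-insert-last : ∀ {m n} (w : Vec (Fin m) (suc n)) →
        adjacent (insertAt (Vec.map suc w) (fromℕ (suc n)) zero) ≡ adjacent w
      adjacent-insert-last (a ∷ [])    = trans (ℕ.+-identityʳ _) (q-zero (toℕ a))
      adjacent-insert-last (a ∷ b ∷ w) = cong₂ _+_ (q-suc (toℕ a) (toℕ b)) (adjacent-insert-last (b ∷ w))

  module Leap = Adjacent leap
  module Next = Adjacent next

  leaps successions : ∀ {m n} → Vec (Fin m) (suc n) → ℕ
  leaps       = Leap.adjacent
  successions = Next.adjacent

  -- Splitting ascents this way gives two statistics that exclude each other on every adjacent pair,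
  -- as excedances and fixed points do at every position. Without successions, `leaps` is `asc`.
  asc≡leaps+successions : ∀ {n} (w : Word (suc n)) → asc w ≡ leaps w + successions w
  asc≡leaps+successions w = begin
    asc w
      ≡⟨ count-allFin (λ i → lookup w (inject₁ i) Fin.<? lookup w (suc i)) ⟩
    sum (λ i → indicator (lookup w (inject₁ i) Fin.<? lookup w (suc i)))
      ≡⟨ sum-cong-≗ (λ i → leap+next (toℕ (lookup w (inject₁ i))) (toℕ (lookup w (suc i)))) ⟨
    sum (λ i → Leap.pair w i + Next.pair w i)
      ≡⟨ ∑-distrib-+ (Leap.pair w) (Next.pair w) ⟩
    leaps w + successions w ∎
    where open ≡-Reasoning

  noSuccessions⇒successions≡0 : ∀ {n} (w : Word (suc n)) → NoSuccessions w → successions w ≡ 0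
  noSuccessions⇒successions≡0 w ns = ≡0⇒sum≡0 (Next.pair w) (λ i → ≢⇒next≡0 _ _ (ns i))

  successions≡0⇒noSuccessions : ∀ {n} (w : Word (suc n)) → successions w ≡ 0 → NoSuccessions w
  successions≡0⇒noSuccessions w eq i = next≡0⇒≢ _ _ (sum≡0⇒≡0 (Next.pair w) eq i)

  leap-zero-suc : ∀ b → leap 0 (suc b) ≡ 1 ∸ isZero b
  leap-zero-suc zero    = refl
  leap-zero-suc (suc b) = refl

  next-zero-suc : ∀ b → next 0 (suc b) ≡ isZero b
  next-zero-suc zero    = refl
  next-zero-suc (suc b) = refl

  before-class : ∀ {m n} (w : Vec (Fin m) (suc n)) i →
                 Class (Leap.before w i) (Next.before w i) (isZero (toℕ (lookup w i)))
  before-class w (suc i) = leap-next-class (toℕ (lookup w (inject₁ i))) _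
  before-class w zero with toℕ (lookup w zero)
  ... | zero  = third
  ... | suc _ = none

  isZero-≢0 : ∀ {b} → b ≢ 0 → isZero b ≡ 0
  isZero-≢0 {zero}  b≢0 = contradiction refl b≢0
  isZero-≢0 {suc b} b≢0 = refl

  sum-isZero : ∀ {n} (w : Word (suc n)) → IsPermutation w → sum (λ i → isZero (toℕ (lookup w i))) ≡ 1
  sum-isZero w (inj , surj) = begin
    sum t                                   ≡⟨ sum-remove {i = p} t ⟩
    t p + sum (λ k → t (punchIn p k))       ≡⟨ cong (λ v → isZero (toℕ v) + sum (λ k → t (punchIn p k))) w-p ⟩
    1 + sum (λ k → t (punchIn p k))         ≡⟨ cong (1 +_) (≡0⇒sum≡0 _ λ k → isZero-≢0 λ eq →
                                                 Fin.punchInᵢ≢i p k (inj (trans (Fin.toℕ-injective eq) (sym w-p)))) ⟩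
    1 ∎
    where
    open ≡-Reasoning
    t = λ i → isZero (toℕ (lookup w i))
    p = proj₁ (surj zero)
    w-p : lookup w p ≡ zero
    w-p = proj₂ (surj zero) refl

  -- Sends p to 0 and the remaining positions, in order, to 1, ..., n, so `insert` becomes the usual
  -- insertion of a letter at place p.
  τ-word : ∀ {n} → Fin (suc n) → Permutation′ (suc n)
  τ-word p = FinPerm.insert p zero FinPerm.id

  τ-word-zero : ∀ {n} (p : Fin (suc n)) → τ-word p ⟨$⟩ʳ p ≡ zero
  τ-word-zero p with p Fin.≟ p
  ... | yes _  = refl
  ... | no p≢p = contradiction refl p≢p

  module WordInsertion {n : ℕ} where
    open Insertion {n} τ-word τ-word-zero public

    -- The permutation form yields the bijection `𝔖-suc`; the structural form allows adjacent pairs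
    -- to be followed by induction on the vector.
    insert≡insertAt : ∀ w p → insert w p ≡ insertAt (Vec.map suc w) p zero
    insert≡insertAt w p = lookup-ext pointwise
      where
      pointwise : ∀ i → lookup (insert w p) i ≡ lookup (insertAt (Vec.map suc w) p zero) i
      pointwise i with p Fin.≟ i
      ... | yes refl = trans (lookup-insert w p p) (trans (cong (lookup (extend w)) (τ-word-zero p))
                         (sym (insertAt-lookup (Vec.map suc w) p zero)))
      ... | no p≢i   = subst (λ k → lookup (insert w p) k ≡ lookup (insertAt (Vec.map suc w) p zero) k)
                         (Fin.punchIn-punchOut p≢i) (at-punchIn (Fin.punchOut p≢i))
        where
        at-punchIn : ∀ j → lookup (insert w p) (punchIn p j) ≡ lookup (insertAt (Vec.map suc w) p zero) (punchIn p j)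
        at-punchIn j = trans (lookup-insert w p (punchIn p j))
          (trans (cong (lookup (extend w)) (FinPerm.insert-punchIn p zero FinPerm.id j))
                 (sym (insertAt-punchIn (Vec.map suc w) p zero j)))

  module _ {n : ℕ} (w : Word (suc n)) where
    open WordInsertion {suc n}

    -- The new pair (0 , b + 1) is a succession when b = 0 and a leap otherwise.
    leaps-insert : ∀ i → leaps (insert w (inject₁ i)) + Leap.before w i ≡ leaps w + (1 ∸ isZero (toℕ (lookup w i)))
    leaps-insert i = trans (cong (λ v → leaps v + Leap.before w i) (insert≡insertAt w (inject₁ i)))
      (trans (Leap.adjacent-insert (λ _ _ → refl) (λ _ → refl) w i)
             (cong (leaps w +_) (leap-zero-suc (toℕ (lookup w i)))))

    successions-insert : ∀ i → successions (insert w (inject₁ i)) + Next.before w i ≡ successions w + isZero (toℕ (lookup w i))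
    successions-insert i = trans (cong (λ v → successions v + Next.before w i) (insert≡insertAt w (inject₁ i)))
      (trans (Next.adjacent-insert (λ _ _ → refl) (λ _ → refl) w i)
             (cong (successions w +_) (next-zero-suc (toℕ (lookup w i)))))

    leaps-insert-last : leaps (insert w (fromℕ (suc n))) ≡ leaps w
    leaps-insert-last = trans (cong leaps (insert≡insertAt w (fromℕ (suc n))))
      (Leap.adjacent-insert-last (λ _ _ → refl) (λ _ → refl) w)

    successions-insert-last : successions (insert w (fromℕ (suc n))) ≡ successions w
    successions-insert-last = trans (cong successions (insert≡insertAt w (fromℕ (suc n))))
      (Next.adjacent-insert-last (λ _ _ → refl) (λ _ → refl) w)

open Permutations

-- From insertions to the two recurrences

module Transitions {c ℓ} {R : CommutativeRing c ℓ} (∂ : Derivation R) (x : CommutativeRing.Carrier R) where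
  open CommutativeRing R hiding (zero)
  open IntegerSolver R
  open Natural R
  open ListSum R
  open Derivation ∂
  open SemiringSum semiring using (sum; sum-cong-≋; sum-init-last)
  open SemiringSum ℕ.+-*-semiring using () renaming (sum to sumℕ; sum-replicate-zero to sumℕ-replicate-zero)
  open SemiringMult semiring using (×-homo-+)
  open RawSemiringDefs (RawRing.rawSemiring rawRing) using (_^_)
  open SetoidReasoning setoid
  open Recurrences ∂ x using (Recurrence)
  module Stat₀ = Statistics ∂ x 0#
  module Stat₁ = Statistics ∂ x 1#
  open TestFunction {R = R} x

  module _ (φ : ℕ → ℕ → Carrier) (e f : ℕ) where

    -- Of m insertion slots, a keep (e , f), b turn a unit of f into one of e, z raise f, and the
    -- remaining m - a - b - z raise e. A single slot is the case m = 1 with indicators.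
    weighted : Carrier → Carrier → Carrier → Carrier → Carrier
    weighted m a b z = a * φ e f + b * φ (suc e) (pred f) + z * φ e (suc f)
                     + (m + - a + - b + - z) * φ (suc e) f

    -- In each class the two equations determine (e′ , f′). The third class is the slot in front of
    -- the letter 0, where a succession arises instead of a leap; cycle insertion has z = 0
    -- throughout.
    transition : ∀ {a b z} → Class a b z → ∀ {e′ f′} → e′ ℕ.+ a ≡ e ℕ.+ (1 ℕ.∸ z) → f′ ℕ.+ b ≡ f ℕ.+ z →
                 φ e′ f′ ≈ weighted 1# (ν a) (ν b) (ν z)
    transition first {e′} {f′} p q = begin
      φ e′ f′  ≡⟨ ≡.cong₂ φ (ℕ.+-cancelʳ-≡ 1 e′ e p) (ℕ.+-cancelʳ-≡ 0 f′ f q) ⟩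
      φ e f
        ≈⟨ solve 4 (λ p q r s → p := (:1 :+ :0) :* p :+ :0 :* q :+ :0 :* r :+ (:1 :+ (:- (:1 :+ :0)) :+ (:- :0) :+ (:- :0)) :* s)
             refl _ (φ (suc e) (pred f)) (φ e (suc f)) (φ (suc e) f) ⟩
      weighted 1# (ν 1) (ν 0) (ν 0) ∎
    transition second {e′} {f′} p q = begin
      φ e′ f′  ≡⟨ ≡.cong₂ φ (≡.trans (≡.sym (ℕ.+-identityʳ e′)) (≡.trans p (ℕ.+-comm e 1)))
                    (≡.cong pred (≡.trans (ℕ.+-comm 1 f′) (≡.trans q (ℕ.+-identityʳ f)))) ⟩
      φ (suc e) (pred f)
        ≈⟨ solve 4 (λ p q r s → q := :0 :* p :+ (:1 :+ :0) :* q :+ :0 :* r :+ (:1 :+ (:- :0) :+ (:- (:1 :+ :0)) :+ (:- :0)) :* s)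
             refl (φ e f) _ (φ e (suc f)) (φ (suc e) f) ⟩
      weighted 1# (ν 0) (ν 1) (ν 0) ∎
    transition third {e′} {f′} p q = begin
      φ e′ f′  ≡⟨ ≡.cong₂ φ (ℕ.+-cancelʳ-≡ 0 e′ e p) (≡.trans (≡.sym (ℕ.+-identityʳ f′)) (≡.trans q (ℕ.+-comm f 1))) ⟩
      φ e (suc f)
        ≈⟨ solve 4 (λ p q r s → r := :0 :* p :+ :0 :* q :+ (:1 :+ :0) :* r :+ (:1 :+ (:- :0) :+ (:- :0) :+ (:- (:1 :+ :0))) :* s)
             refl (φ e f) (φ (suc e) (pred f)) _ (φ (suc e) f) ⟩
      weighted 1# (ν 0) (ν 0) (ν 1) ∎
    transition none {e′} {f′} p q = begin
      φ e′ f′  ≡⟨ ≡.cong₂ φ (≡.trans (≡.sym (ℕ.+-identityʳ e′)) (≡.trans p (ℕ.+-comm e 1))) (ℕ.+-cancelʳ-≡ 0 f′ f q) ⟩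
      φ (suc e) f
        ≈⟨ solve 4 (λ p q r s → s := :0 :* p :+ :0 :* q :+ :0 :* r :+ (:1 :+ (:- :0) :+ (:- :0) :+ (:- :0)) :* s)
             refl (φ e f) (φ (suc e) (pred f)) (φ e (suc f)) _ ⟩
      weighted 1# (ν 0) (ν 0) (ν 0) ∎

    weighted-cong : ∀ {m m′ a a′ b b′ z z′} → m ≈ m′ → a ≈ a′ → b ≈ b′ → z ≈ z′ → weighted m a b z ≈ weighted m′ a′ b′ z′
    weighted-cong m a b z = +-cong (+-cong (+-cong (*-congʳ a) (*-congʳ b)) (*-congʳ z))
      (*-congʳ (+-cong (+-cong (+-cong m (-‿cong a)) (-‿cong b)) (-‿cong z)))

    sum-weighted : ∀ {m} (a b z : Fin m → ℕ) →
      sum (λ j → weighted 1# (ν (a j)) (ν (b j)) (ν (z j))) ≈ weighted (ν m) (ν (sumℕ a)) (ν (sumℕ b)) (ν (sumℕ z))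
    sum-weighted {zero} a b z =
      solve 4 (λ p q r s → :0 := :0 :* p :+ :0 :* q :+ :0 :* r :+ (:0 :+ (:- :0) :+ (:- :0) :+ (:- :0)) :* s)
        refl (φ e f) (φ (suc e) (pred f)) (φ e (suc f)) (φ (suc e) f)
    sum-weighted {suc m} a b z = begin
      weighted 1# a₀ b₀ z₀ + sum (λ j → weighted 1# (ν (a (suc j))) (ν (b (suc j))) (ν (z (suc j))))
        ≈⟨ +-congˡ (sum-weighted (a ∘ suc) (b ∘ suc) (z ∘ suc)) ⟩
      weighted 1# a₀ b₀ z₀ + weighted (ν m) a₁ b₁ z₁
        ≈⟨ solve 11 (λ p q r s m a b z a′ b′ z′ →
             (a :* p :+ b :* q :+ z :* r :+ (:1 :+ (:- a) :+ (:- b) :+ (:- z)) :* s)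
               :+ (a′ :* p :+ b′ :* q :+ z′ :* r :+ (m :+ (:- a′) :+ (:- b′) :+ (:- z′)) :* s)
             := (a :+ a′) :* p :+ (b :+ b′) :* q :+ (z :+ z′) :* r
               :+ ((:1 :+ m) :+ (:- (a :+ a′)) :+ (:- (b :+ b′)) :+ (:- (z :+ z′))) :* s)
             refl (φ e f) (φ (suc e) (pred f)) (φ e (suc f)) (φ (suc e) f) (ν m) a₀ b₀ z₀ a₁ b₁ z₁ ⟩
      weighted (ν (suc m)) (a₀ + a₁) (b₀ + b₁) (z₀ + z₁)
        ≈⟨ weighted-cong refl (×-homo-+ 1# (a zero) _) (×-homo-+ 1# (b zero) _) (×-homo-+ 1# (z zero) _) ⟨
      weighted (ν (suc m)) (ν (sumℕ a)) (ν (sumℕ b)) (ν (sumℕ z)) ∎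
      where
      a₀ = ν (a zero)
      b₀ = ν (b zero)
      z₀ = ν (z zero)
      a₁ = ν (sumℕ (a ∘ suc))
      b₁ = ν (sumℕ (b ∘ suc))
      z₁ = ν (sumℕ (z ∘ suc))

    sum-transitions : ∀ {m} {a b z e′ f′ : Fin m → ℕ} → (∀ j → Class (a j) (b j) (z j)) →
      (∀ j → e′ j ℕ.+ a j ≡ e ℕ.+ (1 ℕ.∸ z j)) → (∀ j → f′ j ℕ.+ b j ≡ f ℕ.+ z j) →
      sum (λ j → φ (e′ j) (f′ j)) ≈ weighted (ν m) (ν (sumℕ a)) (ν (sumℕ b)) (ν (sumℕ z))
    sum-transitions {a = a} {b} {z} cls p q =
      trans (sum-cong-≋ (λ j → transition (cls j) (p j) (q j))) (sum-weighted a b z)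

  -- Slot 0 creates the new fixed point and slot `suc j` is classified by the status of j, which
  -- uses up all n + 1 slots: k = 0.
  derangement-step : ∀ n φ →
    ∑ (𝔖 (suc n)) (λ w → φ (exc w) (fix w)) ≈ ∑ (𝔖 n) (λ w → Stat₀.insertion n φ (exc w) (fix w))
  derangement-step n φ = begin
    ∑ (𝔖 (suc n)) ψ
      ≈⟨ ∑-↭ ψ 𝔖-suc ⟩
    ∑ (cartesianProductWith insert (𝔖 n) (allFin (suc n))) ψ
      ≈⟨ ∑-cartesianProductWith insert (𝔖 n) (allFin (suc n)) ψ ⟩
    ∑ (𝔖 n) (λ w → ∑ (allFin (suc n)) (ψ ∘ insert w))
      ≈⟨ ∑-cong (𝔖 n) (λ w → trans (∑-tabulate id (ψ ∘ insert w)) (single w)) ⟩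
    ∑ (𝔖 n) (λ w → Stat₀.insertion n φ (exc w) (fix w)) ∎
    where
    open Cycle {n}
    ψ : Word (suc n) → Carrier
    ψ v = φ (exc v) (fix v)
    single : ∀ w → sum (ψ ∘ insert w) ≈ Stat₀.insertion n φ (exc w) (fix w)
    single w = begin
      ψ (insert w zero) + sum (λ j → ψ (insert w (suc j)))
        ≈⟨ +-cong (reflexive (≡.cong₂ φ (exc-insert-zero w) (fix-insert-zero w)))
             (sum-transitions φ (exc w) (fix w) (exceed-fixed-class w) (exc-insert-suc w) (fix-insert-suc w)) ⟩
      φ e (suc f) + weighted φ e f (ν n) (ν (sumℕ (exceed w))) (ν f) (ν (sumℕ {n} (λ _ → 0)))
        ≡⟨ ≡.cong₂ (λ i j → φ e (suc f) + weighted φ e f (ν n) (ν i) (ν f) (ν j)) (≡.sym (exc≡sum w)) (sumℕ-replicate-zero n) ⟩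
      φ e (suc f) + weighted φ e f (ν n) (ν e) (ν f) 0#
        ≈⟨ solve 7 (λ p q r s n e f → r :+ (e :* p :+ f :* q :+ :0 :* r :+ (n :+ (:- e) :+ (:- f) :+ (:- :0)) :* s)
             := r :+ e :* p :+ f :* q :+ (n :+ (:- e) :+ (:- f)) :* s :+ :0 :* p)
             refl (φ e f) (φ (suc e) (pred f)) (φ e (suc f)) (φ (suc e) f) (ν n) (ν e) (ν f) ⟩
      Stat₀.insertion n φ e f ∎
      where
      e = exc w
      f = fix w

  -- Of the n + 2 slots, the one in front of the letter 0 creates a succession and the last one
  -- changes neither statistic; the latter is the additional copy, k = 1.
  succession-step : ∀ n φ →
    ∑ (𝔖 (suc (suc n))) (λ w → φ (leaps w) (successions w)) ≈ ∑ (𝔖 (suc n)) (λ w → Stat₁.insertion n φ (leaps w) (successions w))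
  succession-step n φ = begin
    ∑ (𝔖 (suc (suc n))) ψ
      ≈⟨ ∑-↭ ψ 𝔖-suc ⟩
    ∑ (cartesianProductWith insert (𝔖 (suc n)) (allFin (suc (suc n)))) ψ
      ≈⟨ ∑-cartesianProductWith insert (𝔖 (suc n)) (allFin (suc (suc n))) ψ ⟩
    ∑ (𝔖 (suc n)) (λ w → ∑ (allFin (suc (suc n))) (ψ ∘ insert w))
      -- Membership in `𝔖 (suc n)` is carried along because exactly one letter must be 0, see
      -- `sum-isZero`.
      ≈⟨ ∑-cong-∈ (𝔖 (suc n)) (λ {w} w∈ → trans (∑-tabulate id (ψ ∘ insert w)) (single w (∈-𝔖⁻ w∈))) ⟩
    ∑ (𝔖 (suc n)) (λ w → Stat₁.insertion n φ (leaps w) (successions w)) ∎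
    where
    open WordInsertion {suc n}
    ψ : Word (suc (suc n)) → Carrier
    ψ v = φ (leaps v) (successions v)
    single : ∀ w → IsPermutation w → sum (ψ ∘ insert w) ≈ Stat₁.insertion n φ (leaps w) (successions w)
    single w w-perm = begin
      sum (ψ ∘ insert w)
        ≈⟨ sum-init-last (ψ ∘ insert w) ⟩
      sum (λ i → ψ (insert w (inject₁ i))) + ψ (insert w (fromℕ (suc n)))
        ≈⟨ +-cong (sum-transitions φ e f (before-class w) (leaps-insert w) (successions-insert w))
             (reflexive (≡.cong₂ φ (leaps-insert-last w) (successions-insert-last w))) ⟩
      weighted φ e f (ν (suc n)) (ν e) (ν f) (ν (sumℕ (λ i → isZero (toℕ (lookup w i))))) + φ e f
        ≡⟨ ≡.cong (λ j → weighted φ e f (ν (suc n)) (ν e) (ν f) (ν j) + φ e f) (sum-isZero w w-perm) ⟩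
      weighted φ e f (ν (suc n)) (ν e) (ν f) (ν 1) + φ e f
        ≈⟨ solve 7 (λ p q r s n e f → (e :* p :+ f :* q :+ (:1 :+ :0) :* r :+ (:1 :+ n :+ (:- e) :+ (:- f) :+ (:- (:1 :+ :0))) :* s) :+ p
             := r :+ e :* p :+ f :* q :+ (n :+ (:- e) :+ (:- f)) :* s :+ :1 :* p)
             refl (φ e f) (φ (suc e) (pred f)) (φ e (suc f)) (φ (suc e) f) (ν n) (ν e) (ν f) ⟩
      Stat₁.insertion n φ e f ∎
      where
      e = leaps w
      f = successions w

  derangements : ℕ → Carrier
  derangements n = ∑ (filter derangement? (𝔖 n)) (λ w → x ^ exc w)

  successionFree : ℕ → Carrier
  successionFree n = ∑ (𝔖ˢ (suc n)) (λ w → x ^ asc w)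

  recurrence-cong : ∀ {k g h} → (∀ n → g n ≈ h n) → Recurrence k g → Recurrence k h
  recurrence-cong g≈h r = record
    { g-zero = trans (sym (g≈h 0)) (Recurrence.g-zero r)
    ; g-suc  = λ n → trans (sym (g≈h (suc n))) (trans (Recurrence.g-suc r n)
        (+-cong (+-cong (D-cong (g≈h n)) (*-congˡ (g≈h n))) (*-congˡ (*-congˡ (g≈h (pred n))))))
    }

  φ₀-≢0 : ∀ e {f} → f ≡.≢ 0 → φ₀ e f ≈ 0#
  φ₀-≢0 e {zero}  f≢0 = contradiction ≡.refl f≢0
  φ₀-≢0 e {suc f} _   = refl

  module _ (D-x : D x ≈ x * (1# + - x)) where

    derangements-recurrence : Recurrence 0# derangements
    derangements-recurrence = recurrence-cong
      (λ n → sym (∑-filter derangement?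
        (λ {w} der → reflexive (≡.cong (φ₀ (exc w)) (≡.sym (derangement⇒fix≡0 w der))))
        (λ {w} ¬der → φ₀-≢0 (exc w) (¬der ∘ fix≡0⇒derangement w))
        (𝔖 n)))
      (Stat₀.recurrence Word 𝔖 exc fix (λ φ → +-identityʳ _) derangement-step D-x)

    successionFree-recurrence : Recurrence 1# successionFree
    successionFree-recurrence = recurrence-cong
      (λ n → sym (∑-filter noSuccessions?
        (λ {w} ns → reflexive (≡.trans
          (≡.cong (x ^_) (≡.trans (asc≡leaps+successions w)
            (≡.trans (≡.cong (leaps w ℕ.+_) (noSuccessions⇒successions≡0 w ns)) (ℕ.+-identityʳ (leaps w)))))
          (≡.cong (φ₀ (leaps w)) (≡.sym (noSuccessions⇒successions≡0 w ns)))))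
        (λ {w} ¬ns → φ₀-≢0 (leaps w) (¬ns ∘ successions≡0⇒noSuccessions w))
        (𝔖 (suc n))))
      -- Index n stands for length n + 1; the base case is the one-letter word, which has no
      -- adjacent pair.
      (Stat₁.recurrence (Word ∘ suc) (𝔖 ∘ suc) leaps successions (λ φ → +-identityʳ _) succession-step D-x)

-- Rational constants and the specialisation to ℚ⟦x⟧

-- Fractions in ℚ are normalised; passing to unnormalised ones reduces their identities to
-- cross-multiplication in ℤ.
fromℚᵘ-+ : ∀ p q → fromℚᵘ p ℚ.+ fromℚᵘ q ≡ fromℚᵘ (p ℚᵘ.+ q)
fromℚᵘ-+ p q = ℚ.toℚᵘ-injective (ℚᵘ.≃-trans (ℚ.toℚᵘ-homo-+ (fromℚᵘ p) (fromℚᵘ q))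
  (ℚᵘ.≃-trans (ℚᵘ.+-cong (ℚ.toℚᵘ-fromℚᵘ p) (ℚ.toℚᵘ-fromℚᵘ q)) (ℚᵘ.≃-sym (ℚ.toℚᵘ-fromℚᵘ (p ℚᵘ.+ q)))))

fromℚᵘ-* : ∀ p q → fromℚᵘ p ℚ.* fromℚᵘ q ≡ fromℚᵘ (p ℚᵘ.* q)
fromℚᵘ-* p q = ℚ.toℚᵘ-injective (ℚᵘ.≃-trans (ℚ.toℚᵘ-homo-* (fromℚᵘ p) (fromℚᵘ q))
  (ℚᵘ.≃-trans (ℚᵘ.*-cong (ℚ.toℚᵘ-fromℚᵘ p) (ℚ.toℚᵘ-fromℚᵘ q)) (ℚᵘ.≃-sym (ℚ.toℚᵘ-fromℚᵘ (p ℚᵘ.* q)))))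

module _ where
  open IntegerSolver ℤ.+-*-commutativeRing

  1+n/1 : ∀ n → ℚ.1ℚ ℚ.+ (ℤ.+ n ℚ./ 1) ≡ ℤ.+ suc n ℚ./ 1
  1+n/1 n = ≡.trans (fromℚᵘ-+ 1ᵘ nᵘ) (ℚ.fromℚᵘ-cong {1ᵘ ℚᵘ.+ nᵘ} {mkℚᵘ (ℤ.+ suc n) 0} (*≡*
    (solve 1 (λ k → (:1 :* :1 :+ k :* :1) :* :1 := (:1 :+ k) :* :1) ≡.refl (ℤ.+ n))))
    where
    1ᵘ = mkℚᵘ ℤ.1ℤ 0
    nᵘ = mkℚᵘ (ℤ.+ n) 0

  m/1*n/1 : ∀ m n → (ℤ.+ m ℚ./ 1) ℚ.* (ℤ.+ n ℚ./ 1) ≡ ℤ.+ (m ℕ.* n) ℚ./ 1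
  m/1*n/1 m n = ≡.trans (fromℚᵘ-* mᵘ nᵘ) (ℚ.fromℚᵘ-cong {mᵘ ℚᵘ.* nᵘ} {mkℚᵘ (ℤ.+ (m ℕ.* n)) 0} (*≡*
    (≡.cong (ℤ._* ℤ.1ℤ) (≡.sym (ℤ.pos-* m n)))))
    where
    mᵘ = mkℚᵘ (ℤ.+ m) 0
    nᵘ = mkℚᵘ (ℤ.+ n) 0

  m/1*1/[m*d] : ∀ m d .⦃ _ : ℕ.NonZero d ⦄ .⦃ _ : ℕ.NonZero (suc m ℕ.* d) ⦄ →
                (ℤ.+ suc m ℚ./ 1) ℚ.* (ℤ.1ℤ ℚ./ (suc m ℕ.* d)) ≡ ℤ.1ℤ ℚ./ d
  m/1*1/[m*d] m (suc d) = ≡.trans (fromℚᵘ-* mᵘ 1/mdᵘ) (ℚ.fromℚᵘ-cong {mᵘ ℚᵘ.* 1/mdᵘ} {mkℚᵘ ℤ.1ℤ d} (*≡* (begin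
    ℤ.+ suc m ℤ.* ℤ.1ℤ ℤ.* ℤ.+ suc d
      ≡⟨ solve 2 (λ a b → a :* :1 :* b := :1 :* (a :* b)) ≡.refl (ℤ.+ suc m) (ℤ.+ suc d) ⟩
    ℤ.1ℤ ℤ.* (ℤ.+ suc m ℤ.* ℤ.+ suc d)
      ≡⟨ ≡.cong (ℤ.1ℤ ℤ.*_) (≡.sym (ℤ.pos-* (suc m) (suc d))) ⟩
    ℤ.1ℤ ℤ.* ℤ.+ (suc m ℕ.* suc d)
      ≡⟨ ≡.cong (λ k → ℤ.1ℤ ℤ.* ℤ.+ k) (≡.sym (ℕ.*-identityˡ (suc m ℕ.* suc d))) ⟩
    ℤ.1ℤ ℤ.* ℤ.+ (1 ℕ.* (suc m ℕ.* suc d)) ∎)))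
    where
    open ≡.≡-Reasoning
    mᵘ    = mkℚᵘ (ℤ.+ suc m) 0
    -- `mkℚᵘ` stores the denominator minus one, and (m + 1)(d + 1) - 1 = d + m (d + 1).
    1/mdᵘ = mkℚᵘ ℤ.1ℤ (d ℕ.+ m ℕ.* suc d)

module Rational where
  ℚ-ring : CommutativeRing _ _
  ℚ-ring = ℚ.+-*-commutativeRing

  ℚ⟦x⟧-ring : CommutativeRing _ _
  ℚ⟦x⟧-ring = SeriesRing.commutativeRing ℚ-ring

  open CommutativeRing ℚ⟦x⟧-ring hiding (zero)
  open SeriesRing ℚ-ring using (·-inverse)
  open SeriesDerivations ℚ-ring using (eulerDerivation; euler-const; euler-var; const-+; const-*; const-cong)
  open ℚ⟦x⟧ using (const; x)
  open Natural ℚ⟦x⟧-ring using (ν)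
  open SetoidReasoning setoid

  ∂ : Derivation ℚ⟦x⟧-ring
  ∂ = (1# + - x) • eulerDerivation

  open Derivation ∂

  D-const : ∀ q → D (const q) ≈ 0#
  D-const q = trans (*-congˡ {1# + - x} (euler-const q)) (zeroʳ _)

  D-x : D x ≈ x * (1# + - x)
  D-x = trans (*-congˡ {1# + - x} euler-var) (*-comm _ x)

  ν≈const : ∀ n → ν n ≈ const (ℤ.+ n ℚ./ 1)
  ν≈const zero    = refl
  ν≈const (suc n) = begin
    1# + ν n                              ≈⟨ +-congˡ {1#} (ν≈const n) ⟩
    const ℚ.1ℚ + const (ℤ.+ n ℚ./ 1)      ≈⟨ const-+ ℚ.1ℚ (ℤ.+ n ℚ./ 1) ⟨
    const (ℚ.1ℚ ℚ.+ (ℤ.+ n ℚ./ 1))        ≈⟨ const-cong (1+n/1 n) ⟩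
    const (ℤ.+ suc n ℚ./ 1)               ∎

  ν*const : ∀ n q → ν n * const q ≈ const ((ℤ.+ n ℚ./ 1) ℚ.* q)
  ν*const n q = trans (*-congʳ (ν≈const n)) (sym (const-* (ℤ.+ n ℚ./ 1) q))

  egfData : EgfData ∂
  egfData = record
    { 1/_!   = λ n → const ℚ⟦x⟧⟦z⟧.1/ n !
    ; 1/0!   = refl
    ; 1/suc! = λ n → trans (ν*const (suc n) ℚ⟦x⟧⟦z⟧.1/ suc n !)
        (const-cong (m/1*1/[m*d] n (n !) ⦃ n ℕ.!≢0 ⦄ ⦃ suc n ℕ.!≢0 ⦄))
    ; D-1/!  = λ n → D-const ℚ⟦x⟧⟦z⟧.1/ n !
    ; ½      = const ℚ.½
    ; ½+½    = sym (const-+ ℚ.½ ℚ.½)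
    ; D-½    = D-const ℚ.½
    ; x      = x
    ; D-x    = D-x
    ; u      = 1/[1-x]
    ; 1-x*u  = ·-inverse ℚ.1ℚ 1-x ≡.refl
    }

  open Recurrences ∂ x
  open Transitions ∂ x

  dᴮ½-recurrence : Recurrence 1# dᴮ½
  dᴮ½-recurrence = EgfRecurrence.egf-recurrence egfData (λ n → const (ℤ.+ (n !) ℚ./ 1)) refl
    (λ n → sym (trans (ν*const (suc n) (ℤ.+ (n !) ℚ./ 1)) (const-cong (m/1*n/1 (suc n) (n !)))))
    (λ n → D-const (ℤ.+ (n !) ℚ./ 1))

  -- The comparison of the two recurrences with x d(n) moved across. It exhibits `dᴮ½ n - d n` as
  -- the quotient of d(n + 1) by x, so no division is performed.
  x*[dᴮ½-d] : ∀ n → x * (dᴮ½ n - d n) ≈ d (suc n)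
  x*[dᴮ½-d] n = begin
    x * (dᴮ½ n - d n)
      ≈⟨ solve 3 (λ x b d → x :* (b :- d) := x :* b :- x :* d) refl x (dᴮ½ n) (d n) ⟩
    x * dᴮ½ n - x * d n
      ≈⟨ +-congʳ (x*h≈gₙ₊₁+x*gₙ D-x (derangements-recurrence D-x) dᴮ½-recurrence n) ⟩
    d (suc n) + x * d n - x * d n
      ≈⟨ solve 2 (λ a b → a :+ b :- b := a) refl (d (suc n)) (x * d n) ⟩
    d (suc n) ∎
    where open IntegerSolver ℚ⟦x⟧-ring

  dᴮ½-d+d : ∀ n → dᴮ½ n ≈ dᴮ½ n - d n + d n
  dᴮ½-d+d n = solve 2 (λ b d → b := b :- d :+ d) refl (dᴮ½ n) (d n)
    where open IntegerSolver ℚ⟦x⟧-ring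

  dᴮ½≈asc : ∀ n → dᴮ½ n ≈ Σx^ asc (𝔖ˢ (suc n))
  dᴮ½≈asc = unique dᴮ½-recurrence (successionFree-recurrence D-x)

open ℚ⟦x⟧ using (_≈_; _+_; _*_; x)

theorem15 : (n : ℕ) → 1 ≤ n →
    -- q is d (n + 1) / x: multiplication by x is injective on ℚ⟦x⟧
    (∃ λ q → x * q ≈ d (suc n) × dᴮ½ n ≈ q + d n)
    × dᴮ½ n ≈ Σx^ asc (𝔖ˢ (suc n))
theorem15 n _ = (dᴮ½ n + - d n , x*[dᴮ½-d] n , dᴮ½-d+d n) , dᴮ½≈asc n
  where
  open ℚ⟦x⟧ using (-_)
  open Rational
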